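{- Let $t$ be a closed term of PCF$_{\mathsf H}$, let $\nu$ be a proper nature, and let $\mathfrak m$ be a multi-counter. The following are equivalent: 1. There is a tight derivation of the judgment $\emptyset;\emptyset\vdash^{\mathfrak m}t:[\,]^\nu$ in system $\mathcal H$. 2. There exists a sequence of steps $t=t_0\to_{\rho_1}t_1\to_{\rho_2}\cdots\to_{\rho_n}t_n$ ($n\ge 0$) such that $t_n\in\mathsf{NF}_\nu$ and $\mathfrak m=[\rho_1,\dots,\rho_n]$ (as multisets of rule names).
   Context: **Syntax.** Terms of PCF$_{\mathsf H}$, over a denumerable set of variables $x,y,z,\dots$: $t ::= x \mid \lambda x.t \mid t\,t \mid \mathbf 0 \mid \mathbf S(t) \mid \mathsf{if}(t,t,x.t) \mid \mathsf{fix}\,x.t$. Values: $v ::= \lambda x.t \mid \mathbf k$; natural values: $\mathbf k ::= \mathbf 0 \mid \mathbf S(\mathbf k)$. The variable $x$ is bound in the body of $\lambda x.t$ and $\mathsf{fix}\,x.t$, and in $u$ (only) in $\mathsf{if}(t,s,x.u)$. Terms are taken up to $\alpha$-renaming; $\mathsf{fv}(t)$ is the set of free variables; $t\{x:=s\}$ is capture-avoiding substitution. **Reduction.** The relations $\to_\rho$, for rule names $\rho\in\{\mathtt B,\mathtt{I0},\mathtt{IS},\mathtt F\}$, are defined inductively by: $(\lambda x.t)\,v\to_{\mathtt B} t\{x:=v\}$ ($v$ a value); $\mathsf{if}(\mathbf 0,t,x.s)\to_{\mathtt{I0}} t$; $\mathsf{if}(\mathbf S(\mathbf k),t,x.s)\to_{\mathtt{IS}}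 s\{x:=\mathbf k\}$ ($\mathbf k$ a natural value); $\mathsf{fix}\,x.t\to_{\mathtt F} t\{x:=\mathsf{fix}\,x.t\}$; and if $t\to_\rho t'$ then $t\,s\to_\rho t'\,s$, $s\,t\to_\rho s\,t'$, $\mathbf S(t)\to_\rho\mathbf S(t')$, $\mathsf{if}(t,s,x.u)\to_\rho\mathsf{if}(t',s,x.u)$ (for all $s,u$). **Normal forms.** Proper natures: $\nu\in\{\mathsf{abs},\mathsf{nat}\}$; fallible natures: $\varepsilon\in\{\mathsf{abs},\mathsf{nat},\mathsf{stuck}\}$. The sets $\mathsf{NF}_\varepsilon$ are defined inductively by: $\lambda x.t\in\mathsf{NF}_{\mathsf{abs}}$; if $t\in\mathsf{NF}_\varepsilon$, $s\in\mathsf{NF}_{\varepsilon'}$ and $\varepsilon\ne\mathsf{abs}$ then $t\,s\in\mathsf{NF}_{\mathsf{stuck}}$; $\mathbf 0\in\mathsf{NF}_{\mathsf{nat}}$; if $t\in\mathsf{NF}_{\mathsf{nat}}$ then $\mathbf S(t)\in\mathsf{NF}_{\mathsf{nat}}$; if $t\in\mathsf{NF}_\varepsilon$ and $\varepsilon\neq\mathsf{nat}$ then $\mathbf S(t)\in\mathsf{NF}_{\mathsf{stuck}}$ and $\mathsf{if}(t,s,x.u)\in\mathsf{NF}_{\mathsf{stuck}}$ (any $s,u$). **Types** (all multisets and index sets finite). $\mathsf{abs}$-types: $\mathcal T^?\to\mathcal S$, with $\mathcal T^?$ an optional multitype and $\mathcal S$ a multitype; $\mathsf{nat}$-types: $\underline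 0$ or $\underline S(\mathcal N)$ with $\mathcal N$ a $\mathsf{nat}$-multitype. For $\nu\in\{\mathsf{abs},\mathsf{nat}\}$, a $\nu$-multitype is a multiset of $\nu$-types decorated with $\nu$, written $[\tau_i]^\nu_{i\in I}$ (so $[\,]^{\mathsf{abs}}\ne[\,]^{\mathsf{nat}}$). A multitype $\mathcal T$ is an $\mathsf{abs}$-multitype or a $\mathsf{nat}$-multitype $\mathcal N$. An optional multitype $\mathcal T^?$ is $\bot$ or a multitype; $\mathcal N^?$ denotes $\bot$ or a $\mathsf{nat}$-multitype. A multitype family is a multiset of multitypes $\{\!\{\mathcal T_i\}\!\}_{i\in I}$. Optional multitypes are compatible if one of them is $\bot$ or both have the same nature; the sum $+$ of compatible optional multitypes is multiset union (keeping the nature), with $\bot$ neutral. Subsumption $\mathcal T^?\lhd\mathcal T'$ holds exactly when $\mathcal T^?=\bot$ and $\mathcal T'=[\,]^\nu$ for some proper nature $\nu$, or $\mathcal T^?=\mathcal T'$. **Contexts.** A family context $\Phi$ maps variables to multitype families, with $\mathrm{dom}(\Phi)=\{x\mid\Phi(x)\ne\{\!\{\,\}\!\}\}$ finite; sum is pointwise multiset union. A typing context $\Gamma$ maps variables to optional multitypes, with $\mathrm{dom}(\Gamma)=\{x\mid\Gamma(x)\neq\bot\}$ finite; sum is pointwise, defined when the contexts are pointwise compatible. $\emptyset$ denotes the empty (family or typing) context. Writing a sum presupposes that it is defined. Empty sums are $\emptyset$ for contexts, $\bot$ for optional multitypes, $[\,]$ for multi-counters, and $[\,]^{\mathsf{nat}}$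 for the $\mathsf{nat}$-multitypes in rule t-succ. A multi-counter $\mathfrak m$ is a finite multiset of rule names. **Judgments** $\Phi;\Gamma\vdash^{\mathfrak m}t:\mathcal T$. All judgments satisfy the invariant $\mathrm{dom}(\Phi)\cap\mathrm{dom}(\Gamma)=\emptyset$. Writing $\Phi;(\Gamma,x:\mathcal S^?)$ presupposes $x\notin\mathrm{dom}(\Gamma)\cup\mathrm{dom}(\Phi)$; writing $(\Phi,x:\mathcal F);\Gamma$ presupposes $x\notin\mathrm{dom}(\Phi)\cup\mathrm{dom}(\Gamma)$; $x$ may be assigned $\bot$ (resp. $\{\!\{\,\}\!\}$). **Typing rules of system $\mathcal H$.** - t-var$_1$: $\emptyset;x:\mathcal T\vdash^{[\,]}x:\mathcal T$. - t-var$_2$: $x:\{\!\{\mathcal T\}\!\};\emptyset\vdash^{[\,]}x:\mathcal T$. - t-abs: from $\Phi_i;\Gamma_i,x:\mathcal T_i^?\vdash^{\mathfrak m_i}t:\mathcal S_i$ for all $i\in I$ infer $+_i\Phi_i;+_i\Gamma_i\vdash^{+_i\mathfrak m_i}\lambda x.t:[\mathcal T_i^?\to\mathcal S_i]^{\mathsf{abs}}_{i\in I}$. - t-app: from $\Phi_1;\Gamma_1\vdash^{\mathfrak m_1}t:[\mathcal T^?\to\mathcal S]^{\mathsf{abs}}$, $\mathcal T^?\lhd\mathcal T'$ and $\Phi_2;\Gamma_2\vdash^{\mathfrak m_2}s:\mathcal T'$ infer $\Phi_1+\Phi_2;\Gamma_1+\Gamma_2\vdash^{[\mathtt B]+\mathfrak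 m_1+\mathfrak m_2}t\,s:\mathcal S$. - t-zero: $\emptyset;\emptyset\vdash^{[\,]}\mathbf 0:[\underline 0]^{\mathsf{nat}}_{i\in I}$ (any finite $I$). - t-succ: from $\Phi;\Gamma\vdash^{\mathfrak m}t:\mathcal N$ with $\mathcal N=+_{i\in I}\mathcal N_i$ infer $\Phi;\Gamma\vdash^{\mathfrak m}\mathbf S(t):[\underline S(\mathcal N_i)]^{\mathsf{nat}}_{i\in I}$. - t-ifZero: from $\Phi_1;\Gamma_1\vdash^{\mathfrak m_1}t:[\underline 0]^{\mathsf{nat}}$ and $\Phi_2;\Gamma_2\vdash^{\mathfrak m_2}s:\mathcal T$ infer $\Phi_1+\Phi_2;\Gamma_1+\Gamma_2\vdash^{[\mathtt{I0}]+\mathfrak m_1+\mathfrak m_2}\mathsf{if}(t,s,x.u):\mathcal T$. - t-ifSucc: from $\Phi_1;\Gamma_1\vdash^{\mathfrak m_1}t:[\underline S(\mathcal N)]^{\mathsf{nat}}$, $\mathcal N^?\lhd\mathcal N$ and $\Phi_2;\Gamma_2,x:\mathcal N^?\vdash^{\mathfrak m_2}u:\mathcal T$ infer $\Phi_1+\Phi_2;\Gamma_1+\Gamma_2\vdash^{[\mathtt{IS}]+\mathfrak m_1+\mathfrak m_2}\mathsf{if}(t,s,x.u):\mathcal T$. - t-fix: from $\Phi,x:\{\!\{\mathcal T_i\}\!\}_{i\in I};\Gamma\vdash^{\mathfrak m}t:\mathcal S$ and $\Phi_i;\Gamma_i\vdash^{\mathfrak m_i}\mathsf{fix}\,x.t:\mathcal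 T_i$ for all $i\in I$ infer $\Phi+_i\Phi_i;\Gamma+_i\Gamma_i\vdash^{[\mathtt F]+\mathfrak m+_i\mathfrak m_i}\mathsf{fix}\,x.t:\mathcal S$. Index sets $I$ may be empty. **Tightness.** A multitype is tight if it is $[\,]^\nu$ for a proper nature $\nu$. A derivation of $\Phi;\Gamma\vdash^{\mathfrak m}t:\mathcal T$ is tight if $\Phi$ and $\Gamma$ are both empty and $\mathcal T$ is tight. -}

module Defs where

open import Data.Fin.Base using (Fin; zero; suc)
open import Data.List.Base as List using (List; []; _∷_; [_]; _++_)
open import Data.List.Relation.Binary.Permutation.Homogeneous using (Permutation)
open import Data.List.Relation.Binary.Permutation.Propositional using (_↭_)
open import Data.Maybe.Base as Maybe using (Maybe; just; nothing)
open import Data.Maybe.Relation.Binary.Pointwise as MaybeRel using ()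
open import Data.Nat.Base using (ℕ; zero; suc)
open import Data.Product.Base using (_×_; ∃-syntax)
open import Data.Vec.Functional as Vector using (Vector; toList; updateAt)
open import Data.Vec.Functional.Relation.Binary.Pointwise using (Pointwise)
open import Function.Base using (_∘_; const)
open import Relation.Binary.PropositionalEquality using (_≡_; _≢_)
open import Relation.Nullary.Negation using (¬_)

infixl 7 _·_
infixr 6 _⇒_
infix  8 _^_
infixl 6 _+ᶠ_
infix  4 _≈ᵗ_ _≈_ _≈?_ _≈ᶠ_ _≈ᵍ_ _◁_ _#_
infix  4 _⊕_≔_ _⊕ᵍ_≔_ ⨁_≔_ ⨁ᵍ_≔_
infix  3 _⟶[_]_ _⟶*[_]_ _⨾_⊢[_]_∶_

------------------------------------------------------------------------
-- Syntax

-- Terms up to α-renaming whose free variables are among n de Bruijn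
-- indices; a closed term is a Term 0.

data Term (n : ℕ) : Set where
  var : Fin n → Term n
  ƛ   : Term (suc n) → Term n
  _·_ : Term n → Term n → Term n
  𝟎   : Term n
  𝐒   : Term n → Term n
  if  : Term n → Term n → Term (suc n) → Term n
  fix : Term (suc n) → Term n

data NatValue {n : ℕ} : Term n → Set where
  𝟎 : NatValue 𝟎
  𝐒 : ∀ {k} → NatValue k → NatValue (𝐒 k)

data Value {n : ℕ} : Term n → Set where
  ƛ   : ∀ t → Value (ƛ t)
  nat : ∀ {k} → NatValue k → Value k

ext : ∀ {m n} → (Fin m → Fin n) → Fin (suc m) → Fin (suc n)
ext ρ zero    = zero
ext ρ (suc x) = suc (ρ x)

rename : ∀ {m n} → (Fin m → Fin n) → Term m → Term n
rename ρ (var x)    = var (ρ x)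
rename ρ (ƛ t)      = ƛ (rename (ext ρ) t)
rename ρ (t · s)    = rename ρ t · rename ρ s
rename ρ 𝟎          = 𝟎
rename ρ (𝐒 t)      = 𝐒 (rename ρ t)
rename ρ (if t s u) = if (rename ρ t) (rename ρ s) (rename (ext ρ) u)
rename ρ (fix t)    = fix (rename (ext ρ) t)

exts : ∀ {m n} → (Fin m → Term n) → Fin (suc m) → Term (suc n)
exts σ zero    = var zero
exts σ (suc x) = rename suc (σ x)

subst : ∀ {m n} → (Fin m → Term n) → Term m → Term n
subst σ (var x)    = σ x
subst σ (ƛ t)      = ƛ (subst (exts σ) t)
subst σ (t · s)    = subst σ t · subst σ s
subst σ 𝟎          = 𝟎
subst σ (𝐒 t)      = 𝐒 (subst σ t)
subst σ (if t s u) = if (subst σ t) (subst σ s) (subst (exts σ) u)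
subst σ (fix t)    = fix (subst (exts σ) t)

infix 9 _⟨_⟩

_⟨_⟩ : ∀ {n} → Term (suc n) → Term n → Term n
t ⟨ s ⟩ = subst (λ { zero → s ; (suc x) → var x }) t

------------------------------------------------------------------------
-- Reduction

data Rule : Set where
  B I0 IS F : Rule

data _⟶[_]_ {n : ℕ} : Term n → Rule → Term n → Set where
  β    : ∀ {t v} → Value v → ƛ t · v ⟶[ B ] t ⟨ v ⟩
  if-𝟎 : ∀ {t s} → if 𝟎 t s ⟶[ I0 ] t
  if-𝐒 : ∀ {k t s} → NatValue k → if (𝐒 k) t s ⟶[ IS ] s ⟨ k ⟩
  fix  : ∀ {t} → fix t ⟶[ F ] t ⟨ fix t ⟩
  ·ˡ   : ∀ {ρ t t′ s} → t ⟶[ ρ ] t′ → t · s ⟶[ ρ ] t′ · s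
  ·ʳ   : ∀ {ρ t t′ s} → t ⟶[ ρ ] t′ → s · t ⟶[ ρ ] s · t′
  𝐒    : ∀ {ρ t t′} → t ⟶[ ρ ] t′ → 𝐒 t ⟶[ ρ ] 𝐒 t′
  if   : ∀ {ρ t t′ s u} → t ⟶[ ρ ] t′ → if t s u ⟶[ ρ ] if t′ s u

data _⟶*[_]_ {n : ℕ} : Term n → List Rule → Term n → Set where
  []  : ∀ {t} → t ⟶*[ [] ] t
  _∷_ : ∀ {ρ ρs t t′ t″} → t ⟶[ ρ ] t′ → t′ ⟶*[ ρs ] t″ → t ⟶*[ ρ ∷ ρs ] t″

------------------------------------------------------------------------
-- Normal forms

data Nature : Set where
  abs nat : Nature

data FallibleNature : Set where
  proper : Nature → FallibleNature
  stuck  : FallibleNature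

data NF {n : ℕ} : FallibleNature → Term n → Set where
  ƛ   : ∀ {t} → NF (proper abs) (ƛ t)
  _·_ : ∀ {ε ε′ t s} → NF ε t → NF ε′ s → ε ≢ proper abs → NF stuck (t · s)
  𝟎   : NF (proper nat) 𝟎
  𝐒   : ∀ {t} → NF (proper nat) t → NF (proper nat) (𝐒 t)
  𝐒ˢ  : ∀ {ε t} → NF ε t → ε ≢ proper nat → NF stuck (𝐒 t)
  ifˢ : ∀ {ε t s u} → NF ε t → ε ≢ proper nat → NF stuck (if t s u)

------------------------------------------------------------------------
-- Types

-- Multisets are represented by lists, taken up to the hereditary
-- permutation equivalences defined below. In optional multitypes,
-- ⊥ is nothing.

data Type : Nature → Set
data MultiType : Set

data Type where
  _⇒_  : Maybe MultiType → MultiType → Type abs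
  Zero : Type nat
  Succ : List (Type nat) → Type nat

data MultiType where
  multi : (ν : Nature) → List (Type ν) → MultiType

pattern _^_ τs ν = multi ν τs

data _≈ᵗ_ : ∀ {ν} → Type ν → Type ν → Set
data _≈_ : MultiType → MultiType → Set

data _≈ᵗ_ where
  _⇒_  : ∀ {T T′ S S′} → MaybeRel.Pointwise _≈_ T T′ → S ≈ S′ → (T ⇒ S) ≈ᵗ (T′ ⇒ S′)
  Zero : Zero ≈ᵗ Zero
  Succ : ∀ {N N′} → Permutation _≈ᵗ_ N N′ → Succ N ≈ᵗ Succ N′

data _≈_ where
  multi : ∀ {ν τs σs} → Permutation (_≈ᵗ_ {ν}) τs σs → τs ^ ν ≈ σs ^ ν

_≈?_ : Maybe MultiType → Maybe MultiType → Set
_≈?_ = MaybeRel.Pointwise _≈_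

-- T₁ ⊕ T₂ ≔ T holds when T₁ and T₂ are compatible and their sum is T;
-- there is no case for multitypes of different natures.

data _⊕_≔_ : Maybe MultiType → Maybe MultiType → Maybe MultiType → Set where
  ⊥ˡ  : ∀ {T T′} → T ≈? T′ → nothing ⊕ T ≔ T′
  ⊥ʳ  : ∀ {T T′} → T ≈? T′ → T ⊕ nothing ≔ T′
  sum : ∀ {ν τs σs πs} → Permutation _≈ᵗ_ (τs ++ σs) πs →
        just (τs ^ ν) ⊕ just (σs ^ ν) ≔ just (πs ^ ν)

data ⨁_≔_ : List (Maybe MultiType) → Maybe MultiType → Set where
  []  : ⨁ [] ≔ nothing
  _∷_ : ∀ {T Ts U V} → T ⊕ U ≔ V → ⨁ Ts ≔ U → ⨁ (T ∷ Ts) ≔ V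

data _◁_ : Maybe MultiType → MultiType → Set where
  empty : ∀ {ν} → nothing ◁ [] ^ ν
  equal : ∀ {T T′} → T ≈ T′ → just T ◁ T′

------------------------------------------------------------------------
-- Contexts

Family : Set
Family = List MultiType

FamilyContext : ℕ → Set
FamilyContext = Vector Family

TypingContext : ℕ → Set
TypingContext = Vector (Maybe MultiType)

∅ᶠ : ∀ {n} → FamilyContext n
∅ᶠ = Vector.replicate _ []

∅ᵍ : ∀ {n} → TypingContext n
∅ᵍ = Vector.replicate _ nothing

_↦ᶠ_ : ∀ {n} → Fin n → Family → FamilyContext n
x ↦ᶠ 𝓕 = updateAt ∅ᶠ x (const 𝓕)

_↦ᵍ_ : ∀ {n} → Fin n → Maybe MultiType → TypingContext n
x ↦ᵍ T = updateAt ∅ᵍ x (const T)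

_≈ᶠ_ : ∀ {n} → FamilyContext n → FamilyContext n → Set
_≈ᶠ_ = Pointwise (Permutation _≈_)

_≈ᵍ_ : ∀ {n} → TypingContext n → TypingContext n → Set
_≈ᵍ_ = Pointwise _≈?_

_+ᶠ_ : ∀ {n} → FamilyContext n → FamilyContext n → FamilyContext n
_+ᶠ_ = Vector.zipWith _++_

∑ᶠ : ∀ {n k} → Vector (FamilyContext n) k → FamilyContext n
∑ᶠ Φs x = List.concat (toList λ i → Φs i x)

_⊕ᵍ_≔_ : ∀ {n} → TypingContext n → TypingContext n → TypingContext n → Set
Γ₁ ⊕ᵍ Γ₂ ≔ Γ = ∀ x → Γ₁ x ⊕ Γ₂ x ≔ Γ x

⨁ᵍ_≔_ : ∀ {n k} → Vector (TypingContext n) k → TypingContext n → Set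
⨁ᵍ Γs ≔ Γ = ∀ x → ⨁ toList (λ i → Γs i x) ≔ Γ x

-- The domains of Φ and Γ are disjoint.

_#_ : ∀ {n} → FamilyContext n → TypingContext n → Set
Φ # Γ = ∀ x → ¬ (Φ x ≢ [] × Γ x ≢ nothing)

MultiCounter : Set
MultiCounter = List Rule

∑ᵐ : ∀ {k} → Vector MultiCounter k → MultiCounter
∑ᵐ ms = List.concat (toList ms)

------------------------------------------------------------------------
-- System H

-- Since the components of a judgment matter only up to equivalence,
-- each rule concludes for every representative of the contexts, of the
-- counter and of the type it computes. The premise Φ # Γ is the
-- invariant on judgments; where it is absent it follows from the other
-- premises. Variables bound by λ and by if are pushed with the empty
-- family and variables bound by fix with ⊥, which makes them fresh for
-- the other context.

private
  variable
    n k : ℕ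
    x : Fin n
    t s : Term n
    u : Term (suc n)
    T T′ S : MultiType
    T? : Maybe MultiType
    N : List (Type nat)
    N? : Maybe (List (Type nat))
    Φ Φ₁ Φ₂ : FamilyContext n
    Γ Γ₁ Γ₂ : TypingContext n
    m m₁ m₂ : MultiCounter

data _⨾_⊢[_]_∶_ {n : ℕ} :
  FamilyContext n → TypingContext n → MultiCounter → Term n → MultiType → Set where

  t-var₁ :
    Φ ≈ᶠ ∅ᶠ → Γ ≈ᵍ (x ↦ᵍ just T) → m ↭ [] →
    Φ ⨾ Γ ⊢[ m ] var x ∶ T

  t-var₂ :
    Φ ≈ᶠ (x ↦ᶠ [ T ]) → Γ ≈ᵍ ∅ᵍ → m ↭ [] →
    Φ ⨾ Γ ⊢[ m ] var x ∶ T

  t-abs :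
    {Φs : Vector (FamilyContext n) k} {Γs : Vector (TypingContext n) k}
    {Ts : Vector (Maybe MultiType) k} {Ss : Vector MultiType k}
    {ms : Vector MultiCounter k} →
    (∀ i → ([] Vector.∷ Φs i) ⨾ (Ts i Vector.∷ Γs i) ⊢[ ms i ] u ∶ Ss i) →
    Φ ≈ᶠ ∑ᶠ Φs → ⨁ᵍ Γs ≔ Γ → m ↭ ∑ᵐ ms → Φ # Γ →
    T ≈ toList (λ i → Ts i ⇒ Ss i) ^ abs →
    Φ ⨾ Γ ⊢[ m ] ƛ u ∶ T

  t-app :
    Φ₁ ⨾ Γ₁ ⊢[ m₁ ] t ∶ [ T? ⇒ S ] ^ abs →
    T? ◁ T′ →
    Φ₂ ⨾ Γ₂ ⊢[ m₂ ] s ∶ T′ →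
    Φ ≈ᶠ Φ₁ +ᶠ Φ₂ → Γ₁ ⊕ᵍ Γ₂ ≔ Γ → m ↭ [ B ] ++ m₁ ++ m₂ → Φ # Γ →
    Φ ⨾ Γ ⊢[ m ] t · s ∶ S

  t-zero :
    ∀ k →
    Φ ≈ᶠ ∅ᶠ → Γ ≈ᵍ ∅ᵍ → m ↭ [] →
    T ≈ List.replicate k Zero ^ nat →
    Φ ⨾ Γ ⊢[ m ] 𝟎 ∶ T

  t-succ :
    {Ns : Vector (List (Type nat)) k} →
    Φ ⨾ Γ ⊢[ m ] t ∶ List.concat (toList Ns) ^ nat →
    T ≈ toList (λ i → Succ (Ns i)) ^ nat →
    Φ ⨾ Γ ⊢[ m ] 𝐒 t ∶ T

  t-ifZero :
    Φ₁ ⨾ Γ₁ ⊢[ m₁ ] t ∶ [ Zero ] ^ nat →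
    Φ₂ ⨾ Γ₂ ⊢[ m₂ ] s ∶ T →
    Φ ≈ᶠ Φ₁ +ᶠ Φ₂ → Γ₁ ⊕ᵍ Γ₂ ≔ Γ → m ↭ [ I0 ] ++ m₁ ++ m₂ → Φ # Γ →
    Φ ⨾ Γ ⊢[ m ] if t s u ∶ T

  t-ifSucc :
    Φ₁ ⨾ Γ₁ ⊢[ m₁ ] t ∶ [ Succ N ] ^ nat →
    Maybe.map (multi nat) N? ◁ N ^ nat →
    ([] Vector.∷ Φ₂) ⨾ (Maybe.map (multi nat) N? Vector.∷ Γ₂) ⊢[ m₂ ] u ∶ T →
    Φ ≈ᶠ Φ₁ +ᶠ Φ₂ → Γ₁ ⊕ᵍ Γ₂ ≔ Γ → m ↭ [ IS ] ++ m₁ ++ m₂ → Φ # Γ →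
    Φ ⨾ Γ ⊢[ m ] if t s u ∶ T

  t-fix :
    {Ts : Vector MultiType k}
    {Φ₀ : FamilyContext n} {Γ₀ : TypingContext n} {m₀ : MultiCounter}
    {Φs : Vector (FamilyContext n) k} {Γs : Vector (TypingContext n) k}
    {ms : Vector MultiCounter k} →
    (toList Ts Vector.∷ Φ₀) ⨾ (nothing Vector.∷ Γ₀) ⊢[ m₀ ] u ∶ S →
    (∀ i → Φs i ⨾ Γs i ⊢[ ms i ] fix u ∶ Ts i) →
    Φ ≈ᶠ Φ₀ +ᶠ ∑ᶠ Φs → ⨁ᵍ (Γ₀ Vector.∷ Γs) ≔ Γ → m ↭ [ F ] ++ m₀ ++ ∑ᵐ ms → Φ # Γ →
    Φ ⨾ Γ ⊢[ m ] fix u ∶ S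

IsTight : MultiType → Set
IsTight T = ∃[ ν ] T ≡ [] ^ ν

Tight : Φ ⨾ Γ ⊢[ m ] t ∶ T → Set
Tight {Φ = Φ} {Γ = Γ} {T = T} _ = Φ ≈ᶠ ∅ᶠ × Γ ≈ᵍ ∅ᵍ × IsTight T

{-# OPTIONS --safe #-}
module Submission where

-- Typing is invariant under reduction of closed terms in both directions, with the
-- counter changing by exactly the name of the rule: evaluation never enters a
-- subterm that is typed more than once, because functions, scrutinees and arguments
-- each have exactly one typing premise. A β or successor step substitutes a value,
-- whose typings with T₁ + T₂ are exactly the sums of a typing with T₁ and one with
-- T₂; a fix step substitutes the fixpoint once for every multitype of its family.
-- A typed closed term that is not a value reduces, and a value typed with [] has
-- the empty counter, so the length of the counter bounds the evaluation.

open import Defs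
open import Data.Empty using (⊥)
open import Data.Fin.Base using (Fin; zero; suc)
import Data.Fin.Properties as Fin
open import Data.List.Base as List using (List; []; _∷_; [_]; _++_; concat; length)
import Data.List.Properties as List
open import Data.List.Relation.Binary.Permutation.Homogeneous as Perm
  using (Permutation; refl; prep; swap; trans)
open import Data.List.Relation.Binary.Permutation.Propositional
  using (_↭_; ↭-refl; ↭-sym; ↭-trans; ↭-reflexive; ↭-prep)
import Data.List.Relation.Binary.Permutation.Propositional.Properties as ↭
open import Data.List.Relation.Binary.Pointwise as ListRel using ([]; _∷_)
open import Data.Maybe.Base as Maybe using (Maybe; just; nothing; maybe′)
open import Data.Maybe.Properties using (just-injective)
open import Data.Maybe.Relation.Binary.Pointwise as MaybeRel using (just; nothing)
open import Data.Nat.Base using (ℕ; zero; suc)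
open import Data.Nat.Properties using (suc-injective)
open import Data.Product.Base using (_×_; _,_; proj₂; ∃-syntax; Σ-syntax)
open import Data.Sum.Base using (_⊎_; inj₁; inj₂)
open import Data.Vec.Functional as Vector using (Vector; toList; updateAt)
import Data.Vec.Functional.Properties as Vector
open import Function.Base using (_∘_; const; case_of_)
open import Function.Bundles using (_⇔_; mk⇔)
open import Relation.Binary.PropositionalEquality
  using (_≡_; _≢_; refl; sym; cong; cong₂)
  renaming (trans to ≡-trans; subst to ≡-subst)
open import Relation.Nullary.Decidable using (yes; no)
open import Relation.Nullary.Negation using (contradiction)
open import Algebra.Bundles using (CommutativeMonoid)
open import Algebra.Properties.CommutativeSemigroup
  (CommutativeMonoid.commutativeSemigroup (↭.++-commutativeMonoid {A = Rule}))
  using () renaming (interchange to ++-interchange)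

-- Substitution is needed in three guises, each in both directions: of a value, of a fixpoint, and
-- as plain weakening, which arises because a substituted term is renamed under every binder. One
-- pair of inductions, `push` and `pull`, serves all three; it is abstracted over a `Provision`,
-- which says how typings of the replaced variable are supplied. A value supplies them through an
-- optional multitype: the redex has a single typing of the argument, which must serve all
-- occurrences. A fixpoint is not a value and each of its unfoldings pays for its own steps, so its
-- typings stay apart in a family. The inverse direction is the delicate one: a typing of `t ⟨ s ⟩`
-- is cut where the variable used to be, and the pieces found there must be summable. For a value
-- they are, because every typing of it has the value's own nature. Reduction is followed on closed
-- terms only, so the substituted term has empty contexts and only counters have to be distributed.
-- Multisets are lists and contexts are functions, so equivalences take the place of equalities, and
-- `conv` transports judgments along them.

private
  variable
    n n′ k : ℕ
    ν ν′ : Nature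
    T T′ T₁ T₂ S : MultiType
    U V V′ V₁ V₂ : Maybe MultiType
    𝓕 𝓕′ 𝓕₁ 𝓕₂ : Family
    m m′ m₁ m₂ : MultiCounter

-- Equivalence of types and contexts

_↭ᵗ_ : List (Type ν) → List (Type ν) → Set
_↭ᵗ_ = Permutation _≈ᵗ_

_↭ᶠ_ : Family → Family → Set
_↭ᶠ_ = Permutation _≈_

infix 4 _↭ᵗ_ _↭ᶠ_

-- Types are nested inside lists of types, and a generic reflexivity lemma for lists would hide from
-- the termination checker that the elements are smaller; hence the mutual recursion. The same holds
-- for symmetry below.
≈ᵗ-refl : {τ : Type ν} → τ ≈ᵗ τ
≋-refl : {τs : List (Type ν)} → ListRel.Pointwise _≈ᵗ_ τs τs

≈ᵗ-refl {τ = nothing ⇒ (_ ^ _)}      = nothing ⇒ multi (refl ≋-refl)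
≈ᵗ-refl {τ = just (_ ^ _) ⇒ (_ ^ _)} = just (multi (refl ≋-refl)) ⇒ multi (refl ≋-refl)
≈ᵗ-refl {τ = Zero}                   = Zero
≈ᵗ-refl {τ = Succ _}                 = Succ (refl ≋-refl)

≋-refl {τs = []}    = []
≋-refl {τs = _ ∷ _} = ≈ᵗ-refl ∷ ≋-refl

≈-refl : T ≈ T
≈-refl {T = _ ^ _} = multi (refl ≋-refl)

≈ᵗ-sym : {τ σ : Type ν} → τ ≈ᵗ σ → σ ≈ᵗ τ
≈-sym  : T ≈ T′ → T′ ≈ T
↭ᵗ-sym : {τs σs : List (Type ν)} → τs ↭ᵗ σs → σs ↭ᵗ τs
≋-sym  : {τs σs : List (Type ν)} → ListRel.Pointwise _≈ᵗ_ τs σs → ListRel.Pointwise _≈ᵗ_ σs τs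

≈ᵗ-sym (nothing ⇒ q) = nothing ⇒ ≈-sym q
≈ᵗ-sym (just p ⇒ q)  = just (≈-sym p) ⇒ ≈-sym q
≈ᵗ-sym Zero          = Zero
≈ᵗ-sym (Succ p)      = Succ (↭ᵗ-sym p)

≈-sym (multi p) = multi (↭ᵗ-sym p)

↭ᵗ-sym (refl p)     = refl (≋-sym p)
↭ᵗ-sym (prep e p)   = prep (≈ᵗ-sym e) (↭ᵗ-sym p)
↭ᵗ-sym (swap e f p) = swap (≈ᵗ-sym f) (≈ᵗ-sym e) (↭ᵗ-sym p)
↭ᵗ-sym (trans p q)  = trans (↭ᵗ-sym q) (↭ᵗ-sym p)

≋-sym []      = []
≋-sym (e ∷ p) = ≈ᵗ-sym e ∷ ≋-sym p

≈-trans : T ≈ T₁ → T₁ ≈ T₂ → T ≈ T₂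
≈-trans (multi p) (multi q) = multi (trans p q)

≈?-refl : V ≈? V
≈?-refl = MaybeRel.refl ≈-refl

≈?-sym : U ≈? V → V ≈? U
≈?-sym = MaybeRel.sym ≈-sym

≈?-trans : U ≈? V → V ≈? V′ → U ≈? V′
≈?-trans = MaybeRel.trans ≈-trans

↭ᵗ-refl : {τs : List (Type ν)} → τs ↭ᵗ τs
↭ᵗ-refl = refl ≋-refl

↭ᶠ-refl : 𝓕 ↭ᶠ 𝓕
↭ᶠ-refl = refl (ListRel.refl ≈-refl)

↭ᶠ-sym : 𝓕 ↭ᶠ 𝓕′ → 𝓕′ ↭ᶠ 𝓕
↭ᶠ-sym = Perm.sym ≈-sym

↭ᶠ-reflexive : 𝓕 ≡ 𝓕′ → 𝓕 ↭ᶠ 𝓕′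
↭ᶠ-reflexive refl = ↭ᶠ-refl

≈?-reflexive : V ≡ V′ → V ≈? V′
≈?-reflexive refl = ≈?-refl

-- Brings equivalence back to equality at the one place where this is needed: `Φ # Γ` speaks of
-- literal emptiness. The equation on `ys` lets the recursion through `trans` start at its known
-- right end.
↭[]⇒≡[] : ∀ {a r} {A : Set a} {R : A → A → Set r} {xs ys : List A} →
          Permutation R xs ys → ys ≡ [] → xs ≡ []
↭[]⇒≡[] (refl [])    refl = refl
↭[]⇒≡[] (trans p q) eq    = ↭[]⇒≡[] p (↭[]⇒≡[] q eq)

≈?nothing⇒≡ : V ≈? nothing → V ≡ nothing
≈?nothing⇒≡ nothing = refl

⊕-resp : U ⊕ V ≔ V₁ → V₁ ≈? V₂ → U ⊕ V ≔ V₂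
⊕-resp (⊥ˡ p)  q                = ⊥ˡ (≈?-trans p q)
⊕-resp (⊥ʳ p)  q                = ⊥ʳ (≈?-trans p q)
⊕-resp (sum p) (just (multi q)) = sum (trans p q)

⨁-resp : ∀ {Vs} → ⨁ Vs ≔ V → V ≈? V′ → ⨁ Vs ≔ V′
⨁-resp []       nothing = []
⨁-resp (p ∷ ps) q       = ⊕-resp p q ∷ ps

⊕-nothing : U ⊕ V ≔ V′ → U ≡ nothing → V ≡ nothing → V′ ≡ nothing
⊕-nothing (⊥ˡ nothing) refl refl = refl
⊕-nothing (⊥ʳ nothing) refl refl = refl

∑ᶠ-empty : {Φs : Vector Family k} → (∀ i → Φs i ≡ []) → concat (toList Φs) ≡ []
∑ᶠ-empty {k = zero}  e = refl
∑ᶠ-empty {k = suc _} e = cong₂ _++_ (e zero) (∑ᶠ-empty (e ∘ suc))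

⨁-nothing : {Vs : Vector (Maybe MultiType) k} → (∀ i → Vs i ≡ nothing) → ⨁ toList Vs ≔ V → V ≡ nothing
⨁-nothing {k = zero}  e []       = refl
⨁-nothing {k = suc _} e (p ∷ ps) = ⊕-nothing p (e zero) (⨁-nothing (e ∘ suc) ps)

⨁-empty : ∀ k → ⨁ toList {n = k} (λ _ → nothing) ≔ nothing
⨁-empty zero    = []
⨁-empty (suc k) = ⊥ˡ nothing ∷ ⨁-empty k

private
  variable
    Φ Φ′ : FamilyContext n
    Γ Γ′ : TypingContext n
    t s : Term n

#-resp : Φ ≈ᶠ Φ′ → Γ ≈ᵍ Γ′ → Φ # Γ → Φ′ # Γ′
#-resp p q d x (a , b) =
  d x ( (λ e → a (↭[]⇒≡[] (↭ᶠ-sym (p x)) e))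
      , (λ e → b (≈?nothing⇒≡ (≈?-sym (≈?-trans (≈?-reflexive (sym e)) (q x))))))

module _ {a r} {A : Set a} (_∼_ : A → A → Set r) {d : A} where

  -- Replaces comparison with an `updateAt` by a value at `x` and a default elsewhere, a form that
  -- survives reindexing along a substitution. Families and optional multitypes are both instances.
  at-single : ∀ {f : Vector A n} {x v} → f x ∼ v → (∀ z → z ≢ x → f z ∼ d) →
              ∀ z → f z ∼ updateAt (Vector.replicate n d) x (const v) z
  at-single {n = n} {f} {x} {v} p q z with z Fin.≟ x
  ... | yes refl rewrite Vector.updateAt-updates z {const v} (Vector.replicate n d) = p
  ... | no z≢x   rewrite Vector.updateAt-minimal z x {const v} (Vector.replicate n d) z≢x = q z z≢x

  at-single⁻ : ∀ {f : Vector A n} {x v} → (∀ z → f z ∼ updateAt (Vector.replicate n d) x (const v) z) →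
               f x ∼ v
  at-single⁻ {n = n} {f} {x} {v} p with p x
  ... | q rewrite Vector.updateAt-updates x {const v} (Vector.replicate n d) = q

  off-single⁻ : ∀ {f : Vector A n} {x v} → (∀ z → f z ∼ updateAt (Vector.replicate n d) x (const v) z) →
                ∀ z → z ≢ x → f z ∼ d
  off-single⁻ {n = n} {f} {x} {v} p z z≢x with p z
  ... | q rewrite Vector.updateAt-minimal z x {const v} (Vector.replicate n d) z≢x = q

singleᶠ : ∀ {x : Fin n} → Φ x ↭ᶠ 𝓕 → (∀ z → z ≢ x → Φ z ↭ᶠ []) → Φ ≈ᶠ (x ↦ᶠ 𝓕)
singleᶠ = at-single _↭ᶠ_

singleᵍ : ∀ {x : Fin n} → Γ x ≈? V → (∀ z → z ≢ x → Γ z ≈? nothing) → Γ ≈ᵍ (x ↦ᵍ V)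
singleᵍ = at-single _≈?_

-- `t-app`, `t-ifZero`, `t-ifSucc` and `t-fix` take their type from a premise, so `T ≈ T′` has to
-- travel up to that premise; `t-succ` passes the contexts and the counter up in the same way.
conv : Φ ⨾ Γ ⊢[ m ] t ∶ T → Φ ≈ᶠ Φ′ → Γ ≈ᵍ Γ′ → m ↭ m′ → T ≈ T′ → Φ′ ⨾ Γ′ ⊢[ m′ ] t ∶ T′
conv (t-var₁ a b c) p q r e =
  t-var₁ (λ x → trans (↭ᶠ-sym (p x)) (a x))
         (singleᵍ (≈?-trans (≈?-sym (q _)) (≈?-trans (at-single⁻ _≈?_ b) (just e)))
                  (λ z z≢x → ≈?-trans (≈?-sym (q _)) (off-single⁻ _≈?_ b z z≢x)))
         (↭-trans (↭-sym r) c)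
conv (t-var₂ a b c) p q r e =
  t-var₂ (singleᶠ (trans (↭ᶠ-sym (p _)) (trans (at-single⁻ _↭ᶠ_ a) (prep e ↭ᶠ-refl)))
                  (λ z z≢x → trans (↭ᶠ-sym (p _)) (off-single⁻ _↭ᶠ_ a z z≢x)))
         (λ x → ≈?-trans (≈?-sym (q x)) (b x))
         (↭-trans (↭-sym r) c)
conv (t-abs ds a b c f g) p q r e =
  t-abs ds (λ x → trans (↭ᶠ-sym (p x)) (a x)) (λ x → ⨁-resp (b x) (q x))
        (↭-trans (↭-sym r) c) (#-resp p q f) (≈-trans (≈-sym e) g)
conv (t-app d w d′ a b c f) p q r e =
  t-app (conv d (λ _ → ↭ᶠ-refl) (λ _ → ≈?-refl) ↭-refl (multi (prep (≈?-refl ⇒ e) ↭ᵗ-refl))) w d′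
        (λ x → trans (↭ᶠ-sym (p x)) (a x)) (λ x → ⊕-resp (b x) (q x))
        (↭-trans (↭-sym r) c) (#-resp p q f)
conv (t-zero k a b c g) p q r e =
  t-zero k (λ x → trans (↭ᶠ-sym (p x)) (a x)) (λ x → ≈?-trans (≈?-sym (q x)) (b x))
         (↭-trans (↭-sym r) c) (≈-trans (≈-sym e) g)
conv (t-succ d g) p q r e = t-succ (conv d p q r ≈-refl) (≈-trans (≈-sym e) g)
conv (t-ifZero d d′ a b c f) p q r e =
  t-ifZero d (conv d′ (λ _ → ↭ᶠ-refl) (λ _ → ≈?-refl) ↭-refl e)
           (λ x → trans (↭ᶠ-sym (p x)) (a x)) (λ x → ⊕-resp (b x) (q x))
           (↭-trans (↭-sym r) c) (#-resp p q f)
conv (t-ifSucc {N? = N?} d w d′ a b c f) p q r e =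
  t-ifSucc {N? = N?} d w (conv d′ (λ _ → ↭ᶠ-refl) (λ _ → ≈?-refl) ↭-refl e)
           (λ x → trans (↭ᶠ-sym (p x)) (a x)) (λ x → ⊕-resp (b x) (q x))
           (↭-trans (↭-sym r) c) (#-resp p q f)
conv (t-fix d ds a b c f) p q r e =
  t-fix (conv d (λ _ → ↭ᶠ-refl) (λ _ → ≈?-refl) ↭-refl e) ds
        (λ x → trans (↭ᶠ-sym (p x)) (a x)) (λ x → ⨁-resp (b x) (q x))
        (↭-trans (↭-sym r) c) (#-resp p q f)

recount : m ↭ m′ → Φ ⨾ Γ ⊢[ m ] t ∶ T → Φ ⨾ Γ ⊢[ m′ ] t ∶ T
recount p d = conv d (λ _ → ↭ᶠ-refl) (λ _ → ≈?-refl) p ≈-refl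

-- Counters

infixr 5 _++↭_

_++↭_ : m ↭ m′ → m₁ ↭ m₂ → m ++ m₁ ↭ m′ ++ m₂
_++↭_ = ↭.++⁺

++-identityʳ↭ : m ++ [] ↭ m
++-identityʳ↭ = ↭-reflexive (List.++-identityʳ _)

∑ᵐ-++ : (ms ms′ : Vector MultiCounter k) → ∑ᵐ ms ++ ∑ᵐ ms′ ↭ ∑ᵐ (λ i → ms i ++ ms′ i)
∑ᵐ-++ {zero}  ms ms′ = ↭-refl
∑ᵐ-++ {suc k} ms ms′ =
  ↭-trans (++-interchange (ms zero) (∑ᵐ (ms ∘ suc)) (ms′ zero) (∑ᵐ (ms′ ∘ suc)))
          (↭-refl ++↭ ∑ᵐ-++ (ms ∘ suc) (ms′ ∘ suc))

∑ᵐ-↭ : {ms ms′ : Vector MultiCounter k} → (∀ i → ms i ↭ ms′ i) → ∑ᵐ ms ↭ ∑ᵐ ms′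
∑ᵐ-↭ {zero}  p = ↭-refl
∑ᵐ-↭ {suc k} p = p zero ++↭ ∑ᵐ-↭ (p ∘ suc)

-- The counter m splits into counters mᵢ with D aᵢ mᵢ, one for each aᵢ in as.
Bag : {A : Set} → (A → MultiCounter → Set) → List A → MultiCounter → Set
Bag D []       m = m ↭ []
Bag D (a ∷ as) m = ∃[ m₁ ] ∃[ m₂ ] (D a m₁ × Bag D as m₂ × m ↭ m₁ ++ m₂)

module _ {A : Set} {D : A → MultiCounter → Set} where

  bag-recount : ∀ as → m ↭ m′ → Bag D as m → Bag D as m′
  bag-recount []       p q                     = ↭-trans (↭-sym p) q
  bag-recount (a ∷ as) p (m₁ , m₂ , d , b , q) = m₁ , m₂ , d , b , ↭-trans (↭-sym p) q

  -- Every item carries its own share of the counter, so exchanging two items exchanges their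
  -- shares.
  bag-↭ : ∀ {ℓ} {R : A → A → Set ℓ} → (∀ {a b m} → R a b → D a m → D b m) →
          ∀ {as bs} → Permutation R as bs → Bag D as m → Bag D bs m
  bag-↭ resp (refl [])      b = b
  bag-↭ resp (refl (e ∷ p)) (m₁ , m₂ , d , b , q) =
    m₁ , m₂ , resp e d , bag-↭ resp (refl p) b , q
  bag-↭ resp (prep e p)     (m₁ , m₂ , d , b , q) =
    m₁ , m₂ , resp e d , bag-↭ resp p b , q
  bag-↭ resp (swap e f p)   (m₁ , m₂ , d , (m₃ , m₄ , d′ , b , q′) , q) =
    m₃ , m₁ ++ m₄ , resp f d′ , (m₁ , m₄ , resp e d , bag-↭ resp p b , ↭-refl) ,
    ↭-trans q (↭-trans (↭-refl {x = m₁} ++↭ q′) (↭.shifts m₁ m₃))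
  bag-↭ resp (trans p p′)   b = bag-↭ resp p′ (bag-↭ resp p b)

  bag-++⁺ : ∀ {as bs} → Bag D as m₁ → Bag D bs m₂ → Bag D (as ++ bs) (m₁ ++ m₂)
  bag-++⁺ {as = []}     b b′ = bag-recount _ (↭-sym b ++↭ ↭-refl) b′
  bag-++⁺ {as = _ ∷ as} (m₃ , m₄ , d , b , q) b′ =
    m₃ , m₄ ++ _ , d , bag-++⁺ {as = as} b b′ ,
    ↭-trans (q ++↭ ↭-refl) (↭.++-assoc m₃ m₄ _)

  bag-++⁻ : ∀ as {bs} → Bag D (as ++ bs) m →
            ∃[ m₁ ] ∃[ m₂ ] (Bag D as m₁ × Bag D bs m₂ × m ↭ m₁ ++ m₂)
  bag-++⁻ []       b = [] , _ , ↭-refl , b , ↭-refl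
  bag-++⁻ (a ∷ as) (m₁ , m₂ , d , b , q) with bag-++⁻ as b
  ... | m₃ , m₄ , b₁ , b₂ , q′ =
    m₁ ++ m₃ , m₄ , (m₁ , m₃ , d , b₁ , ↭-refl) , b₂ ,
    ↭-trans q (↭-trans (↭-refl {x = m₁} ++↭ q′) (↭-sym (↭.++-assoc m₁ m₃ m₄)))

  bag-tabulate⁺ : {as : Vector A k} {ms : Vector MultiCounter k} →
                  (∀ i → D (as i) (ms i)) → m ↭ ∑ᵐ ms → Bag D (toList as) m
  bag-tabulate⁺ {k = zero}  ds q = q
  bag-tabulate⁺ {k = suc _} ds q =
    _ , _ , ds zero , bag-tabulate⁺ (ds ∘ suc) ↭-refl , q

  bag-tabulate⁻ : {as : Vector A k} → Bag D (toList as) m →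
                  Σ[ ms ∈ Vector MultiCounter k ] ((∀ i → D (as i) (ms i)) × m ↭ ∑ᵐ ms)
  bag-tabulate⁻ {k = zero}  b = Vector.[] , (λ ()) , b
  bag-tabulate⁻ {k = suc _} (m₁ , m₂ , d , b , q) with bag-tabulate⁻ b
  ... | ms , ds , q′ =
    m₁ Vector.∷ ms , (λ { zero → d ; (suc i) → ds i }) , ↭-trans q (↭-refl ++↭ q′)

  bag-concat⁻ : (ass : Vector (List A) k) → Bag D (concat (toList ass)) m →
                Σ[ ms ∈ Vector MultiCounter k ] ((∀ i → Bag D (ass i) (ms i)) × m ↭ ∑ᵐ ms)
  bag-concat⁻ {k = zero}  ass b = Vector.[] , (λ ()) , b
  bag-concat⁻ {k = suc _} ass b with bag-++⁻ (ass zero) b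
  ... | m₁ , m₂ , b₁ , b₂ , q with bag-concat⁻ (ass ∘ suc) b₂
  ... | ms , ds , q′ =
    m₁ Vector.∷ ms , (λ { zero → b₁ ; (suc i) → ds i }) , ↭-trans q (↭-refl ++↭ q′)

-- Substitution

-- The data consumed by substituting a closed term s for a variable x.
-- Provides 𝓕 V m: when the family and the optional multitype of x are 𝓕 and V,
-- s has typings matching them, of total counter m. Target: the weakenings of s,
-- which are the terms that replace x under binders.
record Provision : Set₁ where
  field
    Provides : Family → Maybe MultiType → MultiCounter → Set
    Target   : ∀ {n} → Term n → Set
    weaken   : ∀ {n} {s : Term n} → Target s → Target (rename suc s)
    resp     : 𝓕 ↭ᶠ 𝓕′ → V ≈? V′ → Provides 𝓕 V m → Provides 𝓕′ V′ m
    none⁺    : Provides [] nothing []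
    none⁻    : Provides [] nothing m → m ↭ []
    split    : ∀ 𝓕₁ → V₁ ⊕ V₂ ≔ V → Provides (𝓕₁ ++ 𝓕₂) V m →
               ∃[ m₁ ] ∃[ m₂ ] (Provides 𝓕₁ V₁ m₁ × Provides 𝓕₂ V₂ m₂ × m ↭ m₁ ++ m₂)
    merge    : Provides 𝓕₁ V₁ m₁ → Provides 𝓕₂ V₂ m₂ →
               ∃[ V ] (V₁ ⊕ V₂ ≔ V × Provides (𝓕₁ ++ 𝓕₂) V (m₁ ++ m₂))
    disjoint : Provides 𝓕 V m → 𝓕 ≢ [] → V ≢ nothing → ⊥
    use₁     : ∀ {n} {s : Term n} → Target s → Provides [] (just T) m → ∅ᶠ ⨾ ∅ᵍ ⊢[ m ] s ∶ T
    use₂     : ∀ {n} {s : Term n} → Target s → Provides [ T ] nothing m → ∅ᶠ ⨾ ∅ᵍ ⊢[ m ] s ∶ T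
    collect  : ∀ {n} {s : Term n} {Φ Γ} → Target s → Φ ⨾ Γ ⊢[ m ] s ∶ T →
               Φ ≈ᶠ ∅ᶠ × Γ ≈ᵍ ∅ᵍ × (Provides [] (just T) m ⊎ Provides [ T ] nothing m)

-- Contexts on one side of a substitution are read off the other side through a `Maybe` index. The
-- default `d` stands where there is no counterpart: it is empty for a variable outside the image,
-- and the provided entry for the replaced variable.
fill : {A : Set} → A → Vector A n → Maybe (Fin n) → A
fill d f = maybe′ f d

fill-suc : ∀ {A : Set} {d a : A} {f : Vector A n} z →
           fill d (a Vector.∷ f) (Maybe.map suc z) ≡ fill d f z
fill-suc nothing  = refl
fill-suc (just _) = refl

everywhere : {Q : Maybe (Fin n) → Set} → Q nothing → (∀ x → Q (just x)) → ∀ z → Q z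
everywhere p q nothing  = p
everywhere p q (just x) = q x

fill-∅ᶠ : Φ ≈ᶠ ∅ᶠ → ∀ z → fill [] Φ z ↭ᶠ []
fill-∅ᶠ a nothing  = ↭ᶠ-refl
fill-∅ᶠ a (just x) = a x

fill-∅ᵍ : Γ ≈ᵍ ∅ᵍ → ∀ z → fill nothing Γ z ≈? nothing
fill-∅ᵍ b nothing  = nothing
fill-∅ᵍ b (just x) = b x

module Substitution (C : Provision) where
  open Provision C

  split* : (𝓕s : Vector Family k) (Vs : Vector (Maybe MultiType) k) →
           ⨁ toList Vs ≔ V → Provides (concat (toList 𝓕s)) V m →
           Σ[ ms ∈ Vector MultiCounter k ] ((∀ i → Provides (𝓕s i) (Vs i) (ms i)) × m ↭ ∑ᵐ ms)
  split* {k = zero}  𝓕s Vs []       p = Vector.[] , (λ ()) , none⁻ p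
  split* {k = suc _} 𝓕s Vs (q ∷ qs) p with split (𝓕s zero) q p
  ... | m₁ , m₂ , p₁ , p₂ , r with split* (𝓕s ∘ suc) (Vs ∘ suc) qs p₂
  ... | ms , ps , r′ =
    m₁ Vector.∷ ms , (λ { zero → p₁ ; (suc i) → ps i }) , ↭-trans r (↭-refl ++↭ r′)

  merge* : (𝓕s : Vector Family k) {Vs : Vector (Maybe MultiType) k} {ms : Vector MultiCounter k} →
           (∀ i → Provides (𝓕s i) (Vs i) (ms i)) →
           ∃[ V ] (⨁ toList Vs ≔ V × Provides (concat (toList 𝓕s)) V (∑ᵐ ms))
  merge* {k = zero}  𝓕s ps = nothing , [] , none⁺
  merge* {k = suc _} 𝓕s ps with merge* (𝓕s ∘ suc) (ps ∘ suc)
  ... | U , q , p with merge (ps zero) p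
  ... | V , q′ , p′ = V , q′ ∷ q , p′

  -- A substitution that replaces at most one variable by a target term and
  -- renames the others injectively; the replaced variable has image nothing.
  record Shape (σ : Fin n → Term n′) : Set where
    field
      image          : Fin n → Maybe (Fin n′)
      preimage       : Maybe (Fin n′) → Maybe (Fin n)
      preimage-image : ∀ x → preimage (image x) ≡ just x
      image-preimage : ∀ z {x} → preimage z ≡ just x → z ≡ image x
      kept           : ∀ x {y} → image x ≡ just y → σ x ≡ var y
      cut            : ∀ x → image x ≡ nothing → Target (σ x)

    preimage-of : ∀ {x z} → image x ≡ z → preimage z ≡ just x
    preimage-of refl = preimage-image _

    image-injective : ∀ {x x′ z} → image x ≡ z → image x′ ≡ z → x ≡ x′
    image-injective eq eq′ = just-injective (≡-trans (sym (preimage-of eq)) (preimage-of eq′))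

    missed : ∀ {x y z} → image x ≡ just y → preimage (just z) ≡ nothing → z ≢ y
    missed eq eq′ refl = case ≡-trans (sym eq′) (preimage-of eq) of λ ()

  -- The bound variable goes to itself and the replaced one, if any, is shifted. Its new target is
  -- the old one weakened, which is why targets must be closed under `weaken`.
  lift : {σ : Fin n → Term n′} → Shape σ → Shape (exts σ)
  lift {n = n} {n′} {σ} sh = record
    { image = image⁺ ; preimage = preimage⁺
    ; preimage-image = preimage-image⁺ ; image-preimage = image-preimage⁺
    ; kept = kept⁺ ; cut = cut⁺ }
    where
    open Shape sh
    image⁺ : Fin (suc n) → Maybe (Fin (suc n′))
    image⁺ zero    = just zero
    image⁺ (suc x) = Maybe.map suc (image x)

    preimage⁺ : Maybe (Fin (suc n′)) → Maybe (Fin (suc n))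
    preimage⁺ nothing        = Maybe.map suc (preimage nothing)
    preimage⁺ (just zero)    = just zero
    preimage⁺ (just (suc y)) = Maybe.map suc (preimage (just y))

    preimage-image⁺ : ∀ x → preimage⁺ (image⁺ x) ≡ just x
    preimage-image⁺ zero = refl
    preimage-image⁺ (suc x) with image x | preimage-image x
    ... | nothing | eq = cong (Maybe.map suc) eq
    ... | just _  | eq = cong (Maybe.map suc) eq

    image-preimage⁺ : ∀ z {x} → preimage⁺ z ≡ just x → z ≡ image⁺ x
    image-preimage⁺ nothing        eq with preimage nothing in eq′
    image-preimage⁺ nothing        refl | just _ = cong (Maybe.map suc) (image-preimage nothing eq′)
    image-preimage⁺ (just zero)    refl = refl
    image-preimage⁺ (just (suc y)) eq with preimage (just y) in eq′
    image-preimage⁺ (just (suc y)) refl | just _ = cong (Maybe.map suc) (image-preimage (just y) eq′)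

    kept⁺ : ∀ x {y} → image⁺ x ≡ just y → exts σ x ≡ var y
    kept⁺ zero    refl = refl
    kept⁺ (suc x) eq with image x in eq′
    kept⁺ (suc x) refl | just _ = cong (rename suc) (kept x eq′)

    cut⁺ : ∀ x → image⁺ x ≡ nothing → Target (exts σ x)
    cut⁺ (suc x) eq with image x in eq′
    cut⁺ (suc x) eq | nothing = weaken (cut x eq′)

  -- Substitution: typings pushed along a shape

  module _ {σ : Fin n → Term n′} (sh : Shape σ) where
    open Shape sh

    pushᶠ : FamilyContext n → FamilyContext n′
    pushᶠ Φ y = fill [] Φ (preimage (just y))

    pushᵍ : TypingContext n → TypingContext n′
    pushᵍ Γ y = fill nothing Γ (preimage (just y))

    Provided : FamilyContext n → TypingContext n → MultiCounter → Set
    Provided Φ Γ = Provides (fill [] Φ (preimage nothing)) (fill nothing Γ (preimage nothing))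

    pullᶠ : FamilyContext n′ → Family → FamilyContext n
    pullᶠ Φ 𝓕 x = fill 𝓕 Φ (image x)

    pullᵍ : TypingContext n′ → Maybe MultiType → TypingContext n
    pullᵍ Γ V x = fill V Γ (image x)

    off-image : ∀ {A : Set} (_∼_ : A → A → Set) {d : A} {f : Vector A n} {x} → d ∼ d →
                (∀ x′ → x′ ≢ x → f x′ ∼ d) → ∀ z → z ≢ image x → fill d f (preimage z) ∼ d
    off-image _∼_ d∼d p z z≢ with preimage z in eq
    ... | nothing = d∼d
    ... | just x′ = p x′ (λ { refl → z≢ (image-preimage z eq) })

    on-image : ∀ {A : Set} (_∼_ : A → A → Set) {d v : A} {f : Vector A n} {x} →
               f x ∼ v → ∀ z → image x ≡ z → fill d f (preimage z) ∼ v
    on-image _∼_ p z eq rewrite preimage-of eq = p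

    ∑ᶠ-fill : ∀ {Φ} (Φs : Vector (FamilyContext n) k) → Φ ≈ᶠ ∑ᶠ Φs →
              ∀ z → fill [] Φ z ↭ᶠ concat (toList (λ i → fill [] (Φs i) z))
    ∑ᶠ-fill {k = k} Φs a nothing  = ↭ᶠ-reflexive (sym (∑ᶠ-empty {k = k} (λ _ → refl)))
    ∑ᶠ-fill         Φs a (just x) = a x

    ⨁ᵍ-fill : ∀ {Γ} (Γs : Vector (TypingContext n) k) → ⨁ᵍ Γs ≔ Γ →
              ∀ z → ⨁ toList (λ i → fill nothing (Γs i) z) ≔ fill nothing Γ z
    ⨁ᵍ-fill Γs b nothing  = ⨁-empty _
    ⨁ᵍ-fill Γs b (just x) = b x

    push-# : ∀ {Φ Γ} → Φ # Γ → pushᶠ Φ # pushᵍ Γ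
    push-# {Φ} {Γ} f y =
      everywhere {Q = λ z → (fill [] Φ z ≢ [] × fill nothing Γ z ≢ nothing) → ⊥}
                 (λ (a , _) → a refl) f (preimage (just y))

    -- If `x` is kept, the replaced variable has empty entries and the provision costs nothing. If
    -- `x` is cut, the pushed contexts are empty and the whole provision becomes the typing of the
    -- substituted term.
    push-var₁ : ∀ {Φ Γ x} → Φ ≈ᶠ ∅ᶠ → Γ ≈ᵍ (x ↦ᵍ just T) → m ↭ [] → Provided Φ Γ m′ →
                pushᶠ Φ ⨾ pushᵍ Γ ⊢[ m ++ m′ ] σ x ∶ T
    push-var₁ {Γ = Γ} {x} a b c p with image x in eq
    ... | just y rewrite kept x eq =
      t-var₁ (λ z → fill-∅ᶠ a (preimage (just z)))
             (singleᵍ (on-image _≈?_ (at-single⁻ _≈?_ b) (just y) eq)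
                      (λ z z≢y → off-image _≈?_ nothing (off-single⁻ _≈?_ b) (just z)
                                   (λ e → z≢y (just-injective (≡-trans e eq)))))
             (c ++↭ none⁻ (resp (fill-∅ᶠ a (preimage nothing))
                                (off-image _≈?_ nothing (off-single⁻ _≈?_ b) nothing
                                  (λ e → case ≡-trans e eq of λ ())) p))
    ... | nothing =
      conv (use₁ (cut x eq) (resp (fill-∅ᶠ a (preimage nothing))
                                  (on-image _≈?_ (at-single⁻ _≈?_ b) nothing eq) p))
           (λ z → ↭ᶠ-sym (fill-∅ᶠ a (preimage (just z))))
           (λ z → ≈?-sym (off-image _≈?_ nothing (off-single⁻ _≈?_ b) (just z)
                            (λ e → case ≡-trans e eq of λ ())))
           (↭-sym c ++↭ ↭-refl) ≈-refl

    push-var₂ : ∀ {Φ Γ x} → Φ ≈ᶠ (x ↦ᶠ [ T ]) → Γ ≈ᵍ ∅ᵍ → m ↭ [] → Provided Φ Γ m′ →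
                pushᶠ Φ ⨾ pushᵍ Γ ⊢[ m ++ m′ ] σ x ∶ T
    push-var₂ {Φ = Φ} {x = x} a b c p with image x in eq
    ... | just y rewrite kept x eq =
      t-var₂ (singleᶠ (on-image _↭ᶠ_ (at-single⁻ _↭ᶠ_ a) (just y) eq)
                      (λ z z≢y → off-image _↭ᶠ_ ↭ᶠ-refl (off-single⁻ _↭ᶠ_ a) (just z)
                                   (λ e → z≢y (just-injective (≡-trans e eq)))))
             (λ z → fill-∅ᵍ b (preimage (just z)))
             (c ++↭ none⁻ (resp (off-image _↭ᶠ_ ↭ᶠ-refl (off-single⁻ _↭ᶠ_ a) nothing
                                  (λ e → case ≡-trans e eq of λ ()))
                                (fill-∅ᵍ b (preimage nothing)) p))
    ... | nothing =
      conv (use₂ (cut x eq) (resp (on-image _↭ᶠ_ (at-single⁻ _↭ᶠ_ a) nothing eq)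
                                  (fill-∅ᵍ b (preimage nothing)) p))
           (λ z → ↭ᶠ-sym (off-image _↭ᶠ_ ↭ᶠ-refl (off-single⁻ _↭ᶠ_ a) (just z)
                            (λ e → case ≡-trans e eq of λ ())))
           (λ z → ≈?-sym (fill-∅ᵍ b (preimage (just z))))
           (↭-sym c ++↭ ↭-refl) ≈-refl

    provided-∷ : ∀ {Φ Γ} → Provided Φ Γ m →
                 Provides (fill [] (𝓕 Vector.∷ Φ) (Maybe.map suc (preimage nothing)))
                          (fill nothing (V Vector.∷ Γ) (Maybe.map suc (preimage nothing))) m
    provided-∷ = resp (↭ᶠ-reflexive (sym (fill-suc (preimage nothing))))
                      (≈?-reflexive (sym (fill-suc (preimage nothing))))

    provided-split : ∀ {Φ Φ₁ Φ₂ Γ Γ₁ Γ₂} → Φ ≈ᶠ Φ₁ +ᶠ Φ₂ → Γ₁ ⊕ᵍ Γ₂ ≔ Γ → Provided Φ Γ m →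
                     ∃[ m₁ ] ∃[ m₂ ] (Provided Φ₁ Γ₁ m₁ × Provided Φ₂ Γ₂ m₂ × m ↭ m₁ ++ m₂)
    provided-split {Φ = Φ} {Φ₁} {Φ₂} {Γ} {Γ₁} {Γ₂} a b p =
      split (fill [] Φ₁ z)
            (everywhere {Q = λ z → fill nothing Γ₁ z ⊕ fill nothing Γ₂ z ≔ fill nothing Γ z}
                        (⊥ˡ nothing) b z)
            (resp (everywhere {Q = λ z → fill [] Φ z ↭ᶠ fill [] Φ₁ z ++ fill [] Φ₂ z} ↭ᶠ-refl a z)
                  ≈?-refl p)
      where z = preimage nothing

    push-+ᶠ : ∀ {Φ Φ₁ Φ₂} → Φ ≈ᶠ Φ₁ +ᶠ Φ₂ → pushᶠ Φ ≈ᶠ pushᶠ Φ₁ +ᶠ pushᶠ Φ₂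
    push-+ᶠ {Φ} {Φ₁} {Φ₂} a y =
      everywhere {Q = λ z → fill [] Φ z ↭ᶠ fill [] Φ₁ z ++ fill [] Φ₂ z} ↭ᶠ-refl a (preimage (just y))

    push-⊕ᵍ : ∀ {Γ Γ₁ Γ₂} → Γ₁ ⊕ᵍ Γ₂ ≔ Γ → pushᵍ Γ₁ ⊕ᵍ pushᵍ Γ₂ ≔ pushᵍ Γ
    push-⊕ᵍ {Γ} {Γ₁} {Γ₂} b y =
      everywhere {Q = λ z → fill nothing Γ₁ z ⊕ fill nothing Γ₂ z ≔ fill nothing Γ z}
                 (⊥ˡ nothing) b (preimage (just y))

  -- The contexts agree pointwise but not by computation: at `suc y` the lifted `preimage` waits for
  -- the value of the original one.
  push-∷ : ∀ {σ : Fin n → Term n′} (sh : Shape σ) {Φ Γ t} →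
           pushᶠ (lift sh) (𝓕 Vector.∷ Φ) ⨾ pushᵍ (lift sh) (V Vector.∷ Γ) ⊢[ m ] t ∶ T →
           (𝓕 Vector.∷ pushᶠ sh Φ) ⨾ (V Vector.∷ pushᵍ sh Γ) ⊢[ m ] t ∶ T
  push-∷ sh d = conv d
    (λ { zero → ↭ᶠ-refl ; (suc y) → ↭ᶠ-reflexive (fill-suc (preimage (just y))) })
    (λ { zero → ≈?-refl ; (suc y) → ≈?-reflexive (fill-suc (preimage (just y))) })
    ↭-refl ≈-refl
    where open Shape sh

  merge-counters : ∀ ρs m₁ m₂ m₁′ m₂′ → m ↭ ρs ++ m₁ ++ m₂ → m′ ↭ m₁′ ++ m₂′ →
                   m ++ m′ ↭ ρs ++ (m₁ ++ m₁′) ++ (m₂ ++ m₂′)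
  merge-counters ρs m₁ m₂ m₁′ m₂′ p q =
    ↭-trans (p ++↭ q) (↭-trans (↭.++-assoc ρs (m₁ ++ m₂) _)
      (↭-refl {x = ρs} ++↭ ++-interchange m₁ m₂ m₁′ m₂′))

  -- The provision is split exactly as the rule splits the entries of the replaced variable among
  -- its premises. Counters therefore just add up, even under a binder whose body is typed many
  -- times or not at all.
  push : ∀ {σ : Fin n → Term n′} (sh : Shape σ) {Φ Γ t} → Φ ⨾ Γ ⊢[ m ] t ∶ T →
         Provided sh Φ Γ m′ → pushᶠ sh Φ ⨾ pushᵍ sh Γ ⊢[ m ++ m′ ] subst σ t ∶ T
  push sh (t-var₁ a b c) p = push-var₁ sh a b c p
  push sh (t-var₂ a b c) p = push-var₂ sh a b c p
  push sh (t-abs {Φs = Φs} {Γs = Γs} {ms = ms} ds a b c f g) p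
    with split* (λ i → fill [] (Φs i) (Shape.preimage sh nothing))
                (λ i → fill nothing (Γs i) (Shape.preimage sh nothing))
                (⨁ᵍ-fill sh Γs b (Shape.preimage sh nothing))
                (resp (∑ᶠ-fill sh Φs a (Shape.preimage sh nothing)) ≈?-refl p)
  ... | ms′ , ps , r =
    t-abs (λ i → push-∷ sh (push (lift sh) (ds i) (provided-∷ sh (ps i))))
          (λ y → ∑ᶠ-fill sh Φs a (Shape.preimage sh (just y)))
          (λ y → ⨁ᵍ-fill sh Γs b (Shape.preimage sh (just y)))
          (↭-trans (c ++↭ r) (∑ᵐ-++ ms ms′)) (push-# sh f) g
  push sh (t-app {m₁ = m₁} {m₂ = m₂} d w d′ a b c f) p with provided-split sh a b p
  ... | m₁′ , m₂′ , p₁ , p₂ , r =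
    t-app (push sh d p₁) w (push sh d′ p₂) (push-+ᶠ sh a) (push-⊕ᵍ sh b)
          (merge-counters [ B ] m₁ m₂ m₁′ m₂′ c r) (push-# sh f)
  push sh (t-zero k a b c g) p =
    t-zero k (λ y → fill-∅ᶠ a (Shape.preimage sh (just y)))
           (λ y → fill-∅ᵍ b (Shape.preimage sh (just y)))
           (c ++↭ none⁻ (resp (fill-∅ᶠ a (Shape.preimage sh nothing))
                              (fill-∅ᵍ b (Shape.preimage sh nothing)) p)) g
  push sh (t-succ d g) p = t-succ (push sh d p) g
  push sh (t-ifZero {m₁ = m₁} {m₂ = m₂} d d′ a b c f) p with provided-split sh a b p
  ... | m₁′ , m₂′ , p₁ , p₂ , r =
    t-ifZero (push sh d p₁) (push sh d′ p₂) (push-+ᶠ sh a) (push-⊕ᵍ sh b)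
             (merge-counters [ I0 ] m₁ m₂ m₁′ m₂′ c r) (push-# sh f)
  push sh (t-ifSucc {m₁ = m₁} {N? = N?} {m₂ = m₂} d w d′ a b c f) p with provided-split sh a b p
  ... | m₁′ , m₂′ , p₁ , p₂ , r =
    t-ifSucc {N? = N?} (push sh d p₁) w (push-∷ sh (push (lift sh) d′ (provided-∷ sh p₂)))
             (push-+ᶠ sh a) (push-⊕ᵍ sh b) (merge-counters [ IS ] m₁ m₂ m₁′ m₂′ c r) (push-# sh f)
  push sh (t-fix {Φ₀ = Φ₀} {Γ₀} {m₀} {Φs} {Γs} {ms} d ds a b c f) p
    -- The typing of the body counts as summand zero, in front of the unfoldings, so one split
    -- serves all premises.
    with split* (λ i → fill [] ((Φ₀ Vector.∷ Φs) i) (Shape.preimage sh nothing))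
                (λ i → fill nothing ((Γ₀ Vector.∷ Γs) i) (Shape.preimage sh nothing))
                (⨁ᵍ-fill sh (Γ₀ Vector.∷ Γs) b (Shape.preimage sh nothing))
                (resp (∑ᶠ-fill sh (Φ₀ Vector.∷ Φs) a (Shape.preimage sh nothing)) ≈?-refl p)
  ... | ms′ , ps , r =
    t-fix {Φ₀ = pushᶠ sh Φ₀} {Φs = λ i → pushᶠ sh (Φs i)}
          (push-∷ sh (push (lift sh) d (provided-∷ sh (ps zero))))
          (λ i → push sh (ds i) (ps (suc i)))
          (λ y → ∑ᶠ-fill sh (Φ₀ Vector.∷ Φs) a (Shape.preimage sh (just y)))
          (λ y → ⨁ᵍ-fill sh (Γ₀ Vector.∷ Γs) b (Shape.preimage sh (just y)))
          (↭-trans (merge-counters [ F ] m₀ (∑ᵐ ms) (ms′ zero) (∑ᵐ (ms′ ∘ suc)) c r)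
            (↭-refl {x = F ∷ m₀ ++ ms′ zero} ++↭ ∑ᵐ-++ ms (ms′ ∘ suc)))
          (push-# sh f)

  -- Anti-substitution: typings pulled back along a shape

  Judged : Term n → MultiType → FamilyContext n → TypingContext n → MultiCounter → Set
  Judged t T Φ Γ m = Φ ⨾ Γ ⊢[ m ] t ∶ T

  JudgedUnder : Family → Maybe MultiType → Term (suc n) → MultiType →
                FamilyContext n → TypingContext n → MultiCounter → Set
  JudgedUnder 𝓕 V t T Φ Γ = Judged t T (𝓕 Vector.∷ Φ) (V Vector.∷ Γ)

  -- The judgment `J` is a parameter so that premises under a binder are treated like the others.
  -- The fields `emptyᶠ` and `emptyᵍ` say that variables outside the image are absent, which makes
  -- pulling back along a renaming a strengthening lemma.
  record Pulled {σ : Fin n → Term n′} (sh : Shape σ)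
                (J : FamilyContext n → TypingContext n → MultiCounter → Set)
                (Φ : FamilyContext n′) (Γ : TypingContext n′) (m : MultiCounter) : Set where
    constructor pulled
    open Shape sh
    field
      {family}   : Family
      {type}     : Maybe MultiType
      {body arg} : MultiCounter
      judged     : J (pullᶠ sh Φ family) (pullᵍ sh Γ type) body
      provision  : Provides family type arg
      counter    : m ↭ body ++ arg
      emptyᶠ     : ∀ y → preimage (just y) ≡ nothing → Φ y ≡ []
      emptyᵍ     : ∀ y → preimage (just y) ≡ nothing → Γ y ≡ nothing

  open Pulled

  module _ {σ : Fin n → Term n′} (sh : Shape σ) where
    open Shape sh

    pull-kept : ∀ {Φ Γ x y} → image x ≡ just y → Φ ⨾ Γ ⊢[ m ] var y ∶ T →
                Pulled sh (Judged (var x) T) Φ Γ m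
    pull-kept {Φ = Φ} {Γ} {x} eq (t-var₁ a b c) = pulled
      (t-var₁ (λ z → fill-∅ᶠ a (image z)) (singleᵍ at off) ↭-refl) none⁺ c
      (λ z _ → ↭[]⇒≡[] (a z) refl)
      (λ z eq′ → ≈?nothing⇒≡ (off-single⁻ _≈?_ b z (missed eq eq′)))
      where
      at : pullᵍ sh Γ nothing x ≈? just _
      at = ≈?-trans (≈?-reflexive (cong (fill nothing Γ) eq)) (at-single⁻ _≈?_ b)
      off : ∀ z → z ≢ x → pullᵍ sh Γ nothing z ≈? nothing
      off z z≢x with image z in eq′
      ... | nothing = nothing
      ... | just y  = off-single⁻ _≈?_ b y (λ { refl → z≢x (image-injective eq′ eq) })
    pull-kept {Φ = Φ} {Γ} {x} eq (t-var₂ a b c) = pulled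
      (t-var₂ (singleᶠ at off) (λ z → fill-∅ᵍ b (image z)) ↭-refl) none⁺ c
      (λ z eq′ → ↭[]⇒≡[] (off-single⁻ _↭ᶠ_ a z (missed eq eq′)) refl)
      (λ z _ → ≈?nothing⇒≡ (b z))
      where
      at : pullᶠ sh Φ [] x ↭ᶠ [ _ ]
      at = trans (↭ᶠ-reflexive (cong (fill [] Φ) eq)) (at-single⁻ _↭ᶠ_ a)
      off : ∀ z → z ≢ x → pullᶠ sh Φ [] z ↭ᶠ []
      off z z≢x with image z in eq′
      ... | nothing = ↭ᶠ-refl
      ... | just y  = off-single⁻ _↭ᶠ_ a y (λ { refl → z≢x (image-injective eq′ eq) })

    pull-cut : ∀ {Φ Γ x} → image x ≡ nothing → Φ ⨾ Γ ⊢[ m ] σ x ∶ T →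
               Pulled sh (Judged (var x) T) Φ Γ m
    pull-cut {T = T} {Φ} {Γ} {x} eq d with collect (cut x eq) d
    ... | a , b , inj₁ p = pulled
      (t-var₁ (λ z → fill-∅ᶠ a (image z)) (singleᵍ at off) ↭-refl) p ↭-refl
      (λ z _ → ↭[]⇒≡[] (a z) refl) (λ z _ → ≈?nothing⇒≡ (b z))
      where
      at : pullᵍ sh Γ (just T) x ≈? just T
      at = ≈?-reflexive (cong (fill (just T) Γ) eq)
      off : ∀ z → z ≢ x → pullᵍ sh Γ (just T) z ≈? nothing
      off z z≢x with image z in eq′
      ... | nothing = contradiction (image-injective eq′ eq) z≢x
      ... | just y  = b y
    ... | a , b , inj₂ p = pulled
      (t-var₂ (singleᶠ at off) (λ z → fill-∅ᵍ b (image z)) ↭-refl) p ↭-refl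
      (λ z _ → ↭[]⇒≡[] (a z) refl) (λ z _ → ≈?nothing⇒≡ (b z))
      where
      at : pullᶠ sh Φ [ T ] x ↭ᶠ [ T ]
      at = ↭ᶠ-reflexive (cong (fill [ T ] Φ) eq)
      off : ∀ z → z ≢ x → pullᶠ sh Φ [ T ] z ↭ᶠ []
      off z z≢x with image z in eq′
      ... | nothing = contradiction (image-injective eq′ eq) z≢x
      ... | just y  = a y

    -- Away from the replaced variable the invariant is inherited; at that variable both entries
    -- come from the provision, and `disjoint` applies.
    pull-# : ∀ {Φ Γ} → Provides 𝓕 V m → Φ # Γ → pullᶠ sh Φ 𝓕 # pullᵍ sh Γ V
    pull-# {𝓕 = 𝓕} {V} {Φ = Φ} {Γ} p f x =
      everywhere {Q = λ z → (fill 𝓕 Φ z ≢ [] × fill V Γ z ≢ nothing) → ⊥}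
                 (λ (a , b) → disjoint p a b) f (image x)

    pull-∷ : ∀ {Φ Γ t} → Pulled (lift sh) (Judged t T) (𝓕 Vector.∷ Φ) (V Vector.∷ Γ) m →
             Pulled sh (JudgedUnder 𝓕 V t T) Φ Γ m
    pull-∷ (pulled d p c e e′) = pulled
      (conv d (λ { zero → ↭ᶠ-refl ; (suc x) → ↭ᶠ-reflexive (fill-suc (image x)) })
              (λ { zero → ≈?-refl ; (suc x) → ≈?-reflexive (fill-suc (image x)) })
              ↭-refl ≈-refl)
      p c (λ y eq → e (suc y) (cong (Maybe.map suc) eq)) (λ y eq → e′ (suc y) (cong (Maybe.map suc) eq))

    -- Each premise yields its own provision; `merge` produces from the two the entry of the
    -- variable in the conclusion. The typing rule itself is an argument, shared by application and
    -- both conditionals.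
    pull₂ : ∀ {J₁ J₂ J Φ Φ₁ Φ₂ Γ Γ₁ Γ₂} ρs →
            Pulled sh J₁ Φ₁ Γ₁ m₁ → Pulled sh J₂ Φ₂ Γ₂ m₂ →
            Φ ≈ᶠ Φ₁ +ᶠ Φ₂ → Γ₁ ⊕ᵍ Γ₂ ≔ Γ → m ↭ ρs ++ m₁ ++ m₂ → Φ # Γ →
            (∀ {Φ Φ₁ Φ₂ Γ Γ₁ Γ₂ m₁ m₂} → J₁ Φ₁ Γ₁ m₁ → J₂ Φ₂ Γ₂ m₂ →
              Φ ≈ᶠ Φ₁ +ᶠ Φ₂ → Γ₁ ⊕ᵍ Γ₂ ≔ Γ → Φ # Γ → J Φ Γ (ρs ++ m₁ ++ m₂)) →
            Pulled sh J Φ Γ m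
    pull₂ {Φ = Φ} {Φ₁} {Φ₂} {Γ} {Γ₁} {Γ₂} ρs
          (pulled {𝓕₁} {V₁} {n₁} {a₁} d₁ p₁ c₁ e₁ e₁′) (pulled {𝓕₂} {V₂} {n₂} {a₂} d₂ p₂ c₂ e₂ e₂′) a b c f rule
      with merge p₁ p₂
    ... | V , q , p = pulled
      (rule d₁ d₂
        (λ x → everywhere {Q = λ z → fill (𝓕₁ ++ 𝓕₂) Φ z ↭ᶠ fill 𝓕₁ Φ₁ z ++ fill 𝓕₂ Φ₂ z} ↭ᶠ-refl a (image x))
        (λ x → everywhere {Q = λ z → fill V₁ Γ₁ z ⊕ fill V₂ Γ₂ z ≔ fill V Γ z} q b (image x))
        (pull-# p f))
      p
      (↭-trans c (↭-trans (↭-refl {x = ρs} ++↭ ↭-trans (c₁ ++↭ c₂) (++-interchange n₁ a₁ n₂ a₂))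
                          (↭-sym (↭.++-assoc ρs _ _))))
      (λ y eq → ↭[]⇒≡[] (a y) (cong₂ _++_ (e₁ y eq) (e₂ y eq)))
      (λ y eq → ⊕-nothing (b y) (e₁′ y eq) (e₂′ y eq))

    pull* : ∀ {J Φ Γ} {Js : Fin k → FamilyContext n → TypingContext n → MultiCounter → Set}
            {Φs : Vector (FamilyContext n′) k} {Γs : Vector (TypingContext n′) k}
            {ms : Vector MultiCounter k} ρs →
            (∀ i → Pulled sh (Js i) (Φs i) (Γs i) (ms i)) →
            Φ ≈ᶠ ∑ᶠ Φs → ⨁ᵍ Γs ≔ Γ → m ↭ ρs ++ ∑ᵐ ms → Φ # Γ →
            (∀ {Φ Γ Φs Γs ms} → (∀ i → Js i (Φs i) (Γs i) (ms i)) →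
              Φ ≈ᶠ ∑ᶠ Φs → ⨁ᵍ Γs ≔ Γ → Φ # Γ → J Φ Γ (ρs ++ ∑ᵐ ms)) →
            Pulled sh J Φ Γ m
    pull* {Φ = Φ} {Γ} {Φs = Φs} {Γs} ρs ps a b c f rule
      with merge* (λ i → family (ps i)) (λ i → provision (ps i))
    ... | V , q , p = pulled
      (rule (λ i → judged (ps i))
        (λ x → everywhere {Q = λ z → fill (concat (toList (λ i → family (ps i)))) Φ z
                                     ↭ᶠ concat (toList (λ i → fill (family (ps i)) (Φs i) z))}
                          ↭ᶠ-refl a (image x))
        (λ x → everywhere {Q = λ z → ⨁ toList (λ i → fill (type (ps i)) (Γs i) z) ≔ fill V Γ z}
                          q b (image x))
        (pull-# p f))
      p
      (↭-trans c (↭-trans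
        (↭-refl {x = ρs} ++↭ ↭-trans (∑ᵐ-↭ (λ i → counter (ps i)))
                                     (↭-sym (∑ᵐ-++ (λ i → body (ps i)) (λ i → arg (ps i)))))
        (↭-sym (↭.++-assoc ρs _ _))))
      (λ y eq → ↭[]⇒≡[] (a y) (∑ᶠ-empty (λ i → emptyᶠ (ps i) y eq)))
      (λ y eq → ⨁-nothing (λ i → emptyᵍ (ps i) y eq) (b y))

  -- The derivation is what decreases: in `t-fix` the unfoldings concern `fix t` again. The split on
  -- `t` is needed to expose the head of `subst σ t`, and to tell a variable from the term put in
  -- its place.
  pull : ∀ {σ : Fin n → Term n′} (sh : Shape σ) {Φ Γ} t → Φ ⨾ Γ ⊢[ m ] subst σ t ∶ T →
         Pulled sh (Judged t T) Φ Γ m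
  pull sh (var x) d with Shape.image sh x in eq
  ... | just y  = pull-kept sh eq (≡-subst (λ s → _ ⨾ _ ⊢[ _ ] s ∶ _) (Shape.kept sh x eq) d)
  ... | nothing = pull-cut sh eq d
  pull sh (ƛ t) (t-abs ds a b c f g) =
    pull* sh [] (λ i → pull-∷ sh (pull (lift sh) t (ds i))) a b c f
      (λ ds a b f → t-abs ds a b ↭-refl f g)
  pull sh (t · s) (t-app d w d′ a b c f) =
    pull₂ sh [ B ] (pull sh t d) (pull sh s d′) a b c f
      (λ d d′ a b f → t-app d w d′ a b ↭-refl f)
  pull sh 𝟎 (t-zero k a b c g) = pulled
    (t-zero k (λ x → fill-∅ᶠ a (Shape.image sh x))
              (λ x → fill-∅ᵍ b (Shape.image sh x)) ↭-refl g)
    none⁺ c (λ y _ → ↭[]⇒≡[] (a y) refl) (λ y _ → ≈?nothing⇒≡ (b y))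
  pull sh (𝐒 t) (t-succ d g) with pull sh t d
  ... | pulled d′ p c e e′ = pulled (t-succ d′ g) p c e e′
  pull sh (if t s u) (t-ifZero d d′ a b c f) =
    pull₂ sh [ I0 ] (pull sh t d) (pull sh s d′) a b c f
      (λ d d′ a b f → t-ifZero d d′ a b ↭-refl f)
  pull sh (if t s u) (t-ifSucc {N? = N?} d w d′ a b c f) =
    pull₂ sh [ IS ] (pull sh t d) (pull-∷ sh (pull (lift sh) u d′)) a b c f
      (λ d d′ a b f → t-ifSucc {N? = N?} d w d′ a b ↭-refl f)
  pull sh (fix t) (t-fix {S = S} {Ts = Ts} {Φ₀} {Γ₀} {m₀} {Φs} {Γs} {ms} d ds a b c f) =
    pull* sh
      {Js = JudgedUnder (toList Ts) nothing t S Vector.∷ (λ i → Judged (fix t) (Ts i))}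
      {Φs = Φ₀ Vector.∷ Φs} {Γs = Γ₀ Vector.∷ Γs} {ms = m₀ Vector.∷ ms} [ F ]
      (λ { zero → pull-∷ sh (pull (lift sh) t d) ; (suc i) → pull sh (fix t) (ds i) }) a b c f
      (λ {_} {_} {Φs} {Γs} {ms} ds a b f →
        t-fix {Φ₀ = Φs zero} {Γ₀ = Γs zero} {m₀ = ms zero} {Φs = Φs ∘ suc} {Γs = Γs ∘ suc} {ms = ms ∘ suc}
              (ds zero) (ds ∘ suc) a (λ x → b x) ↭-refl f)

-- Weakening

-- Stated for any `σ` pointwise equal to the renaming, since under a binder `exts σ` and `ext ρ`
-- correspond only pointwise.
rename≡subst : ∀ {ρ : Fin n → Fin n′} {σ} → (∀ x → σ x ≡ var (ρ x)) → ∀ t → rename ρ t ≡ subst σ t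
rename≡subst {n} {n′} {ρ} {σ} e = go
  where
  e⁺ : ∀ x → exts σ x ≡ var (ext ρ x)
  e⁺ zero    = refl
  e⁺ (suc x) = cong (rename suc) (e x)

  go : ∀ t → rename ρ t ≡ subst σ t
  go (var x)    = sym (e x)
  go (ƛ t)      = cong ƛ (rename≡subst e⁺ t)
  go (t · s)    = cong₂ _·_ (go t) (go s)
  go 𝟎          = refl
  go (𝐒 t)      = cong 𝐒 (go t)
  go (if t s u) = ≡-trans (cong₂ (λ t s → if t s (rename (ext ρ) u)) (go t) (go s))
                          (cong (if _ _) (rename≡subst e⁺ u))
  go (fix t)    = cong fix (rename≡subst e⁺ t)

-- With no target, a Shape is an injective renaming, and Substitution is weakening and strengthening.
nothingProvided : Provision
nothingProvided = record
  { Provides = λ 𝓕 V m → 𝓕 ≡ [] × V ≡ nothing × m ↭ []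
  ; Target   = λ _ → ⊥
  ; weaken   = λ ()
  ; resp     = λ { p q (refl , refl , c) → ↭[]⇒≡[] (↭ᶠ-sym p) refl , ≈?nothing⇒≡ (≈?-sym q) , c }
  ; none⁺    = refl , refl , ↭-refl
  ; none⁻    = λ (_ , _ , c) → c
  ; split    = λ { {𝓕₂ = 𝓕₂} 𝓕₁ (⊥ˡ nothing) (e , refl , c) →
                     [] , [] , (List.++-conicalˡ 𝓕₁ 𝓕₂ e , refl , ↭-refl) ,
                     (List.++-conicalʳ 𝓕₁ 𝓕₂ e , refl , ↭-refl) , c
                 ; {𝓕₂ = 𝓕₂} 𝓕₁ (⊥ʳ nothing) (e , refl , c) →
                     [] , [] , (List.++-conicalˡ 𝓕₁ 𝓕₂ e , refl , ↭-refl) ,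
                     (List.++-conicalʳ 𝓕₁ 𝓕₂ e , refl , ↭-refl) , c }
  ; merge    = λ { (refl , refl , c) (refl , refl , c′) → nothing , ⊥ˡ nothing , refl , refl , (c ++↭ c′) }
  ; disjoint = λ (e , _) a _ → a e
  ; use₁     = λ ()
  ; use₂     = λ ()
  ; collect  = λ ()
  }

module Renaming = Substitution nothingProvided

suc-shape : Renaming.Shape {n} (λ x → var (suc x))
suc-shape = record
  { image          = λ x → just (suc x)
  ; preimage       = λ { (just (suc x)) → just x ; _ → nothing }
  ; preimage-image = λ _ → refl
  ; image-preimage = λ { (just (suc x)) refl → refl }
  ; kept           = λ { _ refl → refl }
  ; cut            = λ _ ()
  }

weaken⁺ : {t : Term n} → ∅ᶠ ⨾ ∅ᵍ ⊢[ m ] t ∶ T → ∅ᶠ ⨾ ∅ᵍ ⊢[ m ] rename suc t ∶ T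
weaken⁺ {t = t} d rewrite rename≡subst {ρ = suc} (λ _ → refl) t =
  conv (Renaming.push suc-shape d (refl , refl , ↭-refl))
       (λ { zero → ↭ᶠ-refl ; (suc _) → ↭ᶠ-refl }) (λ { zero → nothing ; (suc _) → nothing })
       ++-identityʳ↭ ≈-refl

-- Variable `zero` lies outside the image of `suc`, so the emptiness fields of `Pulled` apply to it.
weaken⁻ : ∀ {t : Term n} {Φ Γ} → Φ ⨾ Γ ⊢[ m ] rename suc t ∶ T →
          (Φ ∘ suc) ⨾ (Γ ∘ suc) ⊢[ m ] t ∶ T × Φ zero ≡ [] × Γ zero ≡ nothing
weaken⁻ {t = t} d
  with Renaming.pull suc-shape t (≡-subst (λ s → _ ⨾ _ ⊢[ _ ] s ∶ _) (rename≡subst (λ _ → refl) t) d)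
... | Renaming.pulled d′ (_ , _ , c) c′ e e′ =
  recount (↭-sym (↭-trans c′ (↭-trans (↭-refl ++↭ c) ++-identityʳ↭))) d′ , e zero refl , e′ zero refl

data Weakened (s : Term 0) : ∀ {n} → Term n → Set where
  base : Weakened s s
  step : ∀ {s′ : Term n} → Weakened s s′ → Weakened s (rename suc s′)

Closed : Term 0 → MultiType → MultiCounter → Set
Closed t T m = ∅ᶠ ⨾ ∅ᵍ ⊢[ m ] t ∶ T

-- Over `Fin 0` all contexts are equivalent, vacuously.
close : ∀ {t Φ Γ} → Φ ⨾ Γ ⊢[ m ] t ∶ T → Closed t T m
close d = conv d (λ ()) (λ ()) ↭-refl ≈-refl

retype : ∀ {t} → T ≈ T′ → Closed t T m → Closed t T′ m
retype e d = conv d (λ ()) (λ ()) ↭-refl e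

OpenIn : Family → Maybe MultiType → Term 1 → MultiType → MultiCounter → Set
OpenIn 𝓕 V t T m = (𝓕 Vector.∷ ∅ᶠ) ⨾ (V Vector.∷ ∅ᵍ) ⊢[ m ] t ∶ T

open-resp : ∀ {t Φ Γ} → Φ ⨾ Γ ⊢[ m ] t ∶ T → Φ zero ↭ᶠ 𝓕 → Γ zero ≈? V → T ≈ T′ → OpenIn 𝓕 V t T′ m
open-resp d p q e = conv d (λ { zero → p }) (λ { zero → q }) ↭-refl e

weakened⁺ : ∀ {s} {s′ : Term n} → Weakened s s′ → Closed s T m → ∅ᶠ ⨾ ∅ᵍ ⊢[ m ] s′ ∶ T
weakened⁺ base     d = d
weakened⁺ (step w) d = weaken⁺ (weakened⁺ w d)

weakened⁻ : ∀ {s} {s′ : Term n} {Φ Γ} → Weakened s s′ → Φ ⨾ Γ ⊢[ m ] s′ ∶ T →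
            Φ ≈ᶠ ∅ᶠ × Γ ≈ᵍ ∅ᵍ × Closed s T m
weakened⁻ base     d = (λ ()) , (λ ()) , close d
weakened⁻ (step w) d with weaken⁻ d
... | d′ , e , e′ with weakened⁻ w d′
... | p , q , d″ =
  (λ { zero → ↭ᶠ-reflexive e ; (suc x) → p x }) , (λ { zero → ≈?-reflexive e′ ; (suc x) → q x }) , d″

-- Typed values

data Canonical : Nature → Term 0 → Set where
  ƛ   : ∀ u → Canonical abs (ƛ u)
  nat : ∀ {k} → NatValue k → Canonical nat k

data Element : Term 0 → Type ν → MultiCounter → Set where
  ƛ : ∀ {u} → OpenIn [] V u S m → Element (ƛ u) (V ⇒ S) m
  𝟎 : m ↭ [] → Element 𝟎 Zero m
  𝐒 : ∀ {k N} → Closed k (N ^ nat) m → Element (𝐒 k) (Succ N) m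

element-resp : ∀ {v} {τ σ : Type ν} → τ ≈ᵗ σ → Element v τ m → Element v σ m
element-resp (p ⇒ e)  (ƛ d) = ƛ (open-resp d ↭ᶠ-refl p e)
element-resp Zero     (𝟎 c) = 𝟎 c
element-resp (Succ p) (𝐒 d) = 𝐒 (retype (multi p) d)

private
  variable
    v : Term 0
    τs σs : List (Type ν)

bag-zeros : ∀ j → m ↭ [] → Bag (Element 𝟎) (List.replicate j Zero) m
bag-zeros zero    c = c
bag-zeros (suc j) c = [] , _ , 𝟎 ↭-refl , bag-zeros j c , ↭-refl

canonical-nature : Canonical ν v → Closed v (τs ^ ν′) m → ν ≡ ν′
canonical-nature (ƛ _)       (t-abs _ _ _ _ _ (multi _)) = refl
canonical-nature (nat 𝟎)     (t-zero _ _ _ _ (multi _))  = refl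
canonical-nature (nat (𝐒 _)) (t-succ _ (multi _))        = refl

-- A typing of a value amounts to independent typings at the single types of its multitype, as
-- building a value adds no rule name. This is what makes value typings split and merge freely. The
-- two directions are mutual because regrouping the typings of `𝐒 k` means splitting and merging
-- those of `k`.
bag   : Canonical ν v → Closed v (τs ^ ν′) m → Bag (Element v) τs m
unbag : Canonical ν v → Bag (Element v) τs m → Closed v (τs ^ ν) m

bag (ƛ _) (t-abs ds _ _ c _ (multi p)) =
  bag-↭ element-resp (↭ᵗ-sym p)
    (bag-tabulate⁺ (λ i → ƛ (open-resp (ds i) ↭ᶠ-refl ≈?-refl ≈-refl)) c)
bag (nat 𝟎) (t-zero k _ _ c (multi p)) = bag-↭ element-resp (↭ᵗ-sym p) (bag-zeros k c)
bag (nat (𝐒 k)) (t-succ {Ns = Ns} d (multi p)) with bag-concat⁻ Ns (bag (nat k) (close d))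
... | _ , bs , c = bag-↭ element-resp (↭ᵗ-sym p) (bag-tabulate⁺ (λ i → 𝐒 (unbag (nat k) (bs i))) c)

unbag {τs = []} (ƛ u) c =
  t-abs {k = 0} {Φs = Vector.[]} {Γs = Vector.[]} {Ts = Vector.[]} {Ss = Vector.[]} {ms = Vector.[]}
        (λ ()) (λ ()) (λ ()) c (λ ()) ≈-refl
unbag {τs = (V ⇒ S) ∷ τs} (ƛ u) (m₁ , m₂ , ƛ d , b , c) with unbag (ƛ u) b
... | t-abs {Φs = Φs} {Γs} {Ts} {Ss} {ms} ds _ _ c′ _ (multi p) =
  t-abs {Φs = ∅ᶠ Vector.∷ Φs} {∅ᵍ Vector.∷ Γs} {V Vector.∷ Ts} {S Vector.∷ Ss} {m₁ Vector.∷ ms}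
        (λ { zero → d ; (suc i) → ds i }) (λ ()) (λ ()) (↭-trans c (↭-refl ++↭ c′)) (λ ())
        (multi (prep ≈ᵗ-refl p))
unbag {τs = []} (nat 𝟎) c = t-zero 0 (λ ()) (λ ()) c ≈-refl
unbag {τs = Zero ∷ τs} (nat 𝟎) (m₁ , m₂ , 𝟎 c₁ , b , c) with unbag (nat 𝟎) b
... | t-zero j _ _ c′ (multi p) =
  t-zero (suc j) (λ ()) (λ ()) (↭-trans c (c₁ ++↭ c′)) (multi (prep ≈ᵗ-refl p))
unbag {τs = []} (nat (𝐒 k)) c = t-succ {Ns = Vector.[]} (unbag (nat k) c) ≈-refl
unbag {τs = Succ N ∷ τs} (nat (𝐒 k)) (m₁ , m₂ , 𝐒 d , b , c) with unbag (nat (𝐒 k)) b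
... | t-succ {Ns = Ns} d′ (multi p) =
  t-succ {Ns = N Vector.∷ Ns}
         -- `t-succ` has one premise, so the typings of `k` with `N` and with the sum of `Ns` are
         -- merged into a single one.
         (unbag (nat k) (bag-recount _ (↭-sym c) (bag-++⁺ (bag (nat k) d) (bag (nat k) d′))))
         (multi (prep ≈ᵗ-refl p))

Held : Term 0 → Maybe MultiType → MultiCounter → Set
Held v nothing  m = m ↭ []
Held v (just T) m = Closed v T m

held-resp : V ≈? V′ → Held v V m → Held v V′ m
held-resp nothing  c = c
held-resp (just e) d = retype e d

held-split : Canonical ν v → V₁ ⊕ V₂ ≔ V → Held v V m →
             ∃[ m₁ ] ∃[ m₂ ] (Held v V₁ m₁ × Held v V₂ m₂ × m ↭ m₁ ++ m₂)
held-split cv (⊥ˡ p) h = [] , _ , ↭-refl , held-resp (≈?-sym p) h , ↭-refl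
held-split cv (⊥ʳ p) h = _ , [] , held-resp (≈?-sym p) h , ↭-refl , ↭-sym ++-identityʳ↭
held-split cv (sum {τs = τs} p) h with canonical-nature cv h
... | refl with bag-++⁻ τs (bag-↭ element-resp (↭ᵗ-sym p) (bag cv h))
... | m₁ , m₂ , b₁ , b₂ , c = m₁ , m₂ , unbag cv b₁ , unbag cv b₂ , c

-- Compatibility comes for free: both multitypes have the nature of the value.
held-merge : Canonical ν v → Held v V₁ m₁ → Held v V₂ m₂ →
             ∃[ V ] (V₁ ⊕ V₂ ≔ V × Held v V (m₁ ++ m₂))
held-merge {V₁ = nothing} {V₂ = V₂} cv c h = V₂ , ⊥ˡ ≈?-refl , recount? V₂ h
  where
  recount? : ∀ V → Held _ V _ → Held _ V _
  recount? nothing  c′ = c ++↭ c′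
  recount? (just _) d  = recount (↭-sym c ++↭ ↭-refl) d
held-merge {V₁ = just T} {V₂ = nothing} cv d c =
  just T , ⊥ʳ ≈?-refl , recount (↭-sym (↭-trans (↭-refl ++↭ c) ++-identityʳ↭)) d
held-merge {V₁ = just (τs ^ _)} {V₂ = just (σs ^ _)} cv d d′
  with canonical-nature cv d | canonical-nature cv d′
... | refl | refl = just ((τs ++ σs) ^ _) , sum ↭ᵗ-refl , unbag cv (bag-++⁺ (bag cv d) (bag cv d′))

-- Variables bound by λ and by `if` carry the empty family, so a value is consumed through the
-- optional multitype alone.
valueProvided : Canonical ν v → Provision
valueProvided {v = v} cv = record
  { Provides = λ 𝓕 V m → 𝓕 ≡ [] × Held v V m
  ; Target   = Weakened v
  ; weaken   = step
  ; resp     = λ { p q (refl , h) → ↭[]⇒≡[] (↭ᶠ-sym p) refl , held-resp q h }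
  ; none⁺    = refl , ↭-refl
  ; none⁻    = proj₂
  ; split    = λ { {𝓕₂ = 𝓕₂} 𝓕₁ q (e , h) → case held-split cv q h of λ
                 { (m₁ , m₂ , h₁ , h₂ , c) →
                   m₁ , m₂ , (List.++-conicalˡ 𝓕₁ 𝓕₂ e , h₁) , (List.++-conicalʳ 𝓕₁ 𝓕₂ e , h₂) , c } }
  ; merge    = λ { (refl , h₁) (refl , h₂) → case held-merge cv h₁ h₂ of λ
                 { (V , q , h) → V , q , refl , h } }
  ; disjoint = λ (e , _) a _ → a e
  ; use₁     = λ w (_ , d) → weakened⁺ w d
  ; use₂     = λ { w (() , _) }
  ; collect  = λ w d → case weakened⁻ w d of λ { (p , q , d′) → p , q , inj₁ (refl , d′) }
  }

-- Dually, a variable bound by `fix` carries ⊥. Its family holds one whole typing of the fixpoint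
-- per occurrence that is typed, with no merging of multitypes.
familyProvided : Term 0 → Provision
familyProvided s = record
  { Provides = λ 𝓕 V m → V ≡ nothing × Bag (Closed s) 𝓕 m
  ; Target   = Weakened s
  ; weaken   = step
  ; resp     = λ { p q (refl , b) → ≈?nothing⇒≡ (≈?-sym q) , bag-↭ retype p b }
  ; none⁺    = refl , ↭-refl
  ; none⁻    = proj₂
  ; split    = λ { 𝓕₁ (⊥ˡ nothing) (refl , b) → parts 𝓕₁ b
                 ; 𝓕₁ (⊥ʳ nothing) (refl , b) → parts 𝓕₁ b }
  ; merge    = λ { (refl , b₁) (refl , b₂) → nothing , ⊥ˡ nothing , refl , bag-++⁺ b₁ b₂ }
  ; disjoint = λ (e , _) _ a → a e
  ; use₁     = λ { w (() , _) }
  ; use₂     = λ { w (_ , m₁ , m₂ , d , c , c′) →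
                 weakened⁺ w (recount (↭-sym (↭-trans c′ (↭-trans (↭-refl ++↭ c) ++-identityʳ↭))) d) }
  ; collect  = λ w d → case weakened⁻ w d of λ
                 { (p , q , d′) → p , q , inj₂ (refl , _ , [] , d′ , ↭-refl , ↭-sym ++-identityʳ↭) }
  }
  where
  parts : ∀ 𝓕₁ {𝓕₂} → Bag (Closed s) (𝓕₁ ++ 𝓕₂) m →
          ∃[ m₁ ] ∃[ m₂ ] ((nothing ≡ nothing {A = MultiType} × Bag (Closed s) 𝓕₁ m₁) ×
                           (nothing ≡ nothing {A = MultiType} × Bag (Closed s) 𝓕₂ m₂) × m ↭ m₁ ++ m₂)
  parts 𝓕₁ b with bag-++⁻ 𝓕₁ b
  ... | m₁ , m₂ , b₁ , b₂ , c = m₁ , m₂ , (refl , b₁) , (refl , b₂) , c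

-- Substitution for the only variable of a term

module _ (C : Provision) where
  open Provision C
  open Substitution C

  single-shape : {σ : Fin 1 → Term 0} → Target (σ zero) → Shape σ
  single-shape w = record
    { image          = λ _ → nothing
    ; preimage       = λ { nothing → just zero ; (just ()) }
    ; preimage-image = λ { zero → refl }
    ; image-preimage = λ { nothing _ → refl }
    ; kept           = λ _ ()
    ; cut            = λ { zero _ → w }
    }

  subst-typed : ∀ {t s} → Target s → OpenIn 𝓕 V t T m₁ → Provides 𝓕 V m₂ → Closed (t ⟨ s ⟩) T (m₁ ++ m₂)
  subst-typed w d p = close (push (single-shape w) d p)

  -- The family and the multitype are not given beforehand; they are gathered by `pull` at the
  -- occurrences of `s`.
  subst-typed⁻ : ∀ {t s} → Target s → Closed (t ⟨ s ⟩) T m →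
                 ∃[ 𝓕 ] ∃[ V ] ∃[ m₁ ] ∃[ m₂ ] (OpenIn 𝓕 V t T m₁ × Provides 𝓕 V m₂ × m ↭ m₁ ++ m₂)
  subst-typed⁻ {t = t} w d with pull (single-shape w) t d
  ... | pulled d′ p c _ _ = _ , _ , _ , _ , open-resp d′ ↭ᶠ-refl ≈?-refl ≈-refl , p , c

-- Subject reduction and expansion

-- Subsumption is free on values: a value typed with `[]` has the empty counter, just as ⊥ requires.
held : Canonical ν v → V ◁ T → Closed v T m → Held v V m
held cv empty     d = bag cv d
held cv (equal e) d = retype (≈-sym e) d

-- A value whose variable has ⊥ must still be typed as an argument; it gets `[]` of its own nature.
unheld : Canonical ν v → Held v V m → ∃[ T ] (V ◁ T × Closed v T m)
unheld {V = nothing} cv c = [] ^ _ , empty , unbag cv c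
unheld {V = just T}  cv d = T , equal ≈-refl , d

-- `t-ifSucc` admits only ⊥ or a nat-multitype for its variable, while `pull` returns any optional
-- multitype; the nature of `k` excludes the rest.
unheld-nat : ∀ {k} → NatValue k → Held k V m →
             ∃[ N? ] ∃[ N ] (V ≡ Maybe.map (multi nat) N? × V ◁ N ^ nat × Closed k (N ^ nat) m)
unheld-nat {V = nothing}        k c = nothing , [] , refl , empty , unbag (nat k) c
unheld-nat {V = just (N ^ ν)} k d with canonical-nature (nat k) d
... | refl = just N , N , refl , equal ≈-refl , d

canonical : Value v → ∃[ ν ] Canonical ν v
canonical (ƛ u)   = abs , ƛ u
canonical (nat k) = nat , nat k

private
  variable
    ρ : Rule
    t₁ t₂ s₁ : Term 0
    u : Term 1

app : Closed t₁ ([ V ⇒ S ] ^ abs) m₁ → V ◁ T → Closed s₁ T m₂ → m ↭ B ∷ m₁ ++ m₂ → Closed (t₁ · s₁) S m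
app d w d′ c = t-app d w d′ (λ ()) (λ ()) c (λ ())

ifZero : Closed t₁ ([ Zero ] ^ nat) m₁ → Closed s₁ T m₂ → m ↭ I0 ∷ m₁ ++ m₂ → Closed (if t₁ s₁ u) T m
ifZero d d′ c = t-ifZero d d′ (λ ()) (λ ()) c (λ ())

ifSucc : ∀ {N} N? → Closed t₁ ([ Succ N ] ^ nat) m₁ → Maybe.map (multi nat) N? ◁ N ^ nat →
         OpenIn [] (Maybe.map (multi nat) N?) u T m₂ → m ↭ IS ∷ m₁ ++ m₂ → Closed (if t₁ s₁ u) T m
ifSucc N? d w d′ c = t-ifSucc {N? = N?} d w d′ (λ ()) (λ ()) c (λ ())

lift-left : ∀ ρ′ m′ → m ↭ ρ′ ∷ m₁ ++ m₂ → m₁ ↭ ρ ∷ m′ → m ↭ ρ ∷ ρ′ ∷ m′ ++ m₂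
lift-left {ρ = ρ} ρ′ m′ c c′ =
  ↭-trans c (↭-trans (↭-prep ρ′ (c′ ++↭ ↭-refl)) (↭.shift ρ [ ρ′ ] (m′ ++ _)))

lift-right : ∀ ρ′ m₁ → m ↭ ρ′ ∷ m₁ ++ m₂ → m₂ ↭ ρ ∷ m′ → m ↭ ρ ∷ ρ′ ∷ m₁ ++ m′
lift-right {ρ = ρ} {m′ = m′} ρ′ m₁ c c′ =
  ↭-trans c (↭-trans (↭-refl {x = ρ′ ∷ m₁} ++↭ c′) (↭.shift ρ (ρ′ ∷ m₁) m′))

subject-reduction : t₁ ⟶[ ρ ] t₂ → Closed t₁ T m → ∃[ m′ ] (m ↭ ρ ∷ m′ × Closed t₂ T m′)
subject-reduction (β v) (t-app d w d′ _ _ c _) with canonical v | bag (ƛ _) (close d)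
... | _ , cv | m₃ , m₄ , ƛ d₁ , c₁ , c₂ =
  _ , ↭-trans c (↭-prep B (↭-trans c₂ (↭-trans (↭-refl ++↭ c₁) ++-identityʳ↭) ++↭ ↭-refl)) ,
  subst-typed (valueProvided cv) base d₁ (refl , held cv w (close d′))
subject-reduction if-𝟎 (t-ifZero d d′ _ _ c _) with bag (nat 𝟎) (close d)
... | _ , _ , 𝟎 c₁ , c₂ , c₃ =
  _ , ↭-trans c (↭-prep I0 (↭-trans c₃ (c₁ ++↭ c₂) ++↭ ↭-refl)) , close d′
subject-reduction if-𝟎 (t-ifSucc d _ _ _ _ _ _) with bag (nat 𝟎) (close d)
... | _ , _ , () , _
subject-reduction (if-𝐒 k) (t-ifZero d _ _ _ _ _) with bag (nat (𝐒 k)) (close d)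
... | _ , _ , () , _
subject-reduction (if-𝐒 k) (t-ifSucc {m₂ = m₂} d w d′ _ _ c _) with bag (nat (𝐒 k)) (close d)
... | m₃ , m₄ , 𝐒 d₁ , c₁ , c₂ =
  -- `subst-typed` counts the branch before the substituted value; `t-ifSucc` counts the scrutinee
  -- first.
  m₂ ++ m₃ ,
  ↭-trans c (↭-prep IS (↭-trans (↭-trans c₂ (↭-trans (↭-refl ++↭ c₁) ++-identityʳ↭) ++↭ ↭-refl)
                                (↭.++-comm m₃ m₂))) ,
  subst-typed (valueProvided (nat k)) base (open-resp d′ ↭ᶠ-refl ≈?-refl ≈-refl)
              (refl , held (nat k) w d₁)
subject-reduction fix (t-fix {Ts = Ts} d ds _ _ c _) =
  _ , c ,
  subst-typed (familyProvided _) base (open-resp d ↭ᶠ-refl ≈?-refl ≈-refl)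
              (refl , bag-tabulate⁺ (λ i → close (ds i)) ↭-refl)
subject-reduction (·ˡ r) (t-app d w d′ _ _ c _) with subject-reduction r (close d)
... | _ , c′ , d₁ = _ , lift-left B _ c c′ , app d₁ w (close d′) ↭-refl
subject-reduction (·ʳ r) (t-app {m₁ = m₁} d w d′ _ _ c _) with subject-reduction r (close d′)
... | _ , c′ , d₁ = _ , lift-right B m₁ c c′ , app (close d) w d₁ ↭-refl
subject-reduction (𝐒 r) (t-succ {Ns = Ns} d e) with subject-reduction r d
... | _ , c , d₁ = _ , c , t-succ {Ns = Ns} d₁ e
subject-reduction (if r) (t-ifZero d d′ _ _ c _) with subject-reduction r (close d)
... | _ , c′ , d₁ = _ , lift-left I0 _ c c′ , ifZero d₁ (close d′) ↭-refl
subject-reduction (if r) (t-ifSucc {N? = N?} d w d′ _ _ c _) with subject-reduction r (close d)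
... | _ , c′ , d₁ =
  _ , lift-left IS _ c c′ , ifSucc N? d₁ w (open-resp d′ ↭ᶠ-refl ≈?-refl ≈-refl) ↭-refl

-- The value in head position of a redex is retyped with a singleton bag, which adds nothing to the
-- counter beyond its content; the discarded branch of a conditional stays untyped.
subject-expansion : t₁ ⟶[ ρ ] t₂ → Closed t₂ T m → Closed t₁ T (ρ ∷ m)
subject-expansion (β {t = t} v) d with canonical v
... | _ , cv with subst-typed⁻ (valueProvided cv) {t = t} base d
... | _ , V , m₁ , m₂ , d₁ , (refl , h) , c with unheld {V = V} cv h
... | T , w , d₂ =
  app (unbag (ƛ _) (m₁ , [] , ƛ d₁ , ↭-refl , ↭-sym ++-identityʳ↭)) w d₂ (↭-prep B c)
subject-expansion if-𝟎 d =
  ifZero (unbag (nat 𝟎) ([] , [] , 𝟎 ↭-refl , ↭-refl , ↭-refl)) d ↭-refl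
subject-expansion (if-𝐒 {s = s} k) d with subst-typed⁻ (valueProvided (nat k)) {t = s} base d
... | _ , V , m₁ , m₂ , d₁ , (refl , h) , c with unheld-nat {V = V} k h
... | N? , N , refl , w , d₂ =
  ifSucc N? (unbag (nat (𝐒 k)) (m₂ , [] , 𝐒 d₂ , ↭-refl , ↭-sym ++-identityʳ↭)) w d₁
         (↭-prep IS (↭-trans c (↭.++-comm m₁ m₂)))
subject-expansion (fix {t = t}) d with subst-typed⁻ (familyProvided (fix t)) {t = t} base d
... | 𝓕 , _ , m₁ , m₂ , d₁ , (refl , b) , c
  -- `t-fix` wants the family in the form `toList Ts`; the lookup function of `𝓕` provides such a
  -- `Ts`.
  with bag-tabulate⁻ {as = List.lookup 𝓕} (≡-subst (λ 𝓕 → Bag _ 𝓕 _) (sym (List.tabulate-lookup 𝓕)) b)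
... | ms , ds , c′ =
  t-fix (open-resp d₁ (↭ᶠ-reflexive (sym (List.tabulate-lookup 𝓕))) ≈?-refl ≈-refl) ds
        (λ ()) (λ ()) (↭-prep F (↭-trans c (↭-refl ++↭ c′))) (λ ())
subject-expansion (·ˡ r) (t-app {m₁ = m₁} d w d′ _ _ c _) =
  app (subject-expansion r (close d)) w (close d′)
      (↭-trans (↭-prep _ c) (↭-sym (lift-left B m₁ ↭-refl ↭-refl)))
subject-expansion (·ʳ r) (t-app {m₁ = m₁} d w d′ _ _ c _) =
  app (close d) w (subject-expansion r (close d′))
      (↭-trans (↭-prep _ c) (↭-sym (lift-right B m₁ ↭-refl ↭-refl)))
subject-expansion (𝐒 r) (t-succ {Ns = Ns} d e) = t-succ {Ns = Ns} (subject-expansion r d) e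
subject-expansion (if r) (t-ifZero {m₁ = m₁} d d′ _ _ c _) =
  ifZero (subject-expansion r (close d)) (close d′)
         (↭-trans (↭-prep _ c) (↭-sym (lift-left I0 m₁ ↭-refl ↭-refl)))
subject-expansion (if r) (t-ifSucc {m₁ = m₁} {N? = N?} d w d′ _ _ c _) =
  ifSucc N? (subject-expansion r (close d)) w (open-resp d′ ↭ᶠ-refl ≈?-refl ≈-refl)
         (↭-trans (↭-prep _ c) (↭-sym (lift-left IS m₁ ↭-refl ↭-refl)))

-- Progress

-- The contexts are arbitrary, though without variables, so that the recursion runs on the premises
-- themselves. Stuck terms are excluded by the nature of the typed value, and the wrong conditional
-- rule by its single type.
progress : ∀ {Φ Γ} → Φ ⨾ Γ ⊢[ m ] t₁ ∶ T → (∃[ ν ] Canonical ν t₁) ⊎ (∃[ ρ ] ∃[ t₂ ] t₁ ⟶[ ρ ] t₂)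
progress (t-abs _ _ _ _ _ _) = inj₁ (abs , ƛ _)
progress (t-app d _ d′ _ _ _ _) with progress d
... | inj₂ (_ , _ , r) = inj₂ (_ , _ , ·ˡ r)
... | inj₁ (_ , cv) with canonical-nature cv (close d)
progress (t-app d _ d′ _ _ _ _) | inj₁ (_ , ƛ _) | refl with progress d′
... | inj₂ (_ , _ , r)         = inj₂ (_ , _ , ·ʳ r)
... | inj₁ (_ , ƛ u)           = inj₂ (_ , _ , β (ƛ u))
... | inj₁ (_ , nat k)         = inj₂ (_ , _ , β (nat k))
progress (t-zero _ _ _ _ _) = inj₁ (nat , nat 𝟎)
progress (t-succ d _) with progress d
... | inj₂ (_ , _ , r) = inj₂ (_ , _ , 𝐒 r)
... | inj₁ (_ , cv) with canonical-nature cv (close d)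
progress (t-succ d _) | inj₁ (_ , nat k) | refl = inj₁ (nat , nat (𝐒 k))
progress (t-ifZero d _ _ _ _ _) with progress d
... | inj₂ (_ , _ , r) = inj₂ (_ , _ , if r)
... | inj₁ (_ , cv) with canonical-nature cv (close d) | bag cv (close d)
progress (t-ifZero _ _ _ _ _ _) | inj₁ (_ , nat 𝟎) | refl | _ = inj₂ (_ , _ , if-𝟎)
progress (t-ifZero _ _ _ _ _ _) | inj₁ (_ , nat (𝐒 _)) | refl | _ , _ , () , _
progress (t-ifSucc d _ _ _ _ _ _) with progress d
... | inj₂ (_ , _ , r) = inj₂ (_ , _ , if r)
... | inj₁ (_ , cv) with canonical-nature cv (close d) | bag cv (close d)
progress (t-ifSucc _ _ _ _ _ _ _) | inj₁ (_ , nat 𝟎) | refl | _ , _ , () , _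
progress (t-ifSucc _ _ _ _ _ _ _) | inj₁ (_ , nat (𝐒 k)) | refl | _ = inj₂ (_ , _ , if-𝐒 k)
progress (t-fix _ _ _ _ _ _) = inj₂ (_ , _ , fix)

-- Normal forms and evaluation

natValue-NF : NatValue v → NF (proper nat) v
natValue-NF 𝟎     = 𝟎
natValue-NF (𝐒 k) = 𝐒 (natValue-NF k)

canonical-NF : Canonical ν v → NF (proper ν) v
canonical-NF (ƛ _)   = ƛ
canonical-NF (nat k) = natValue-NF k

NF-natValue : NF (proper nat) v → NatValue v
NF-natValue 𝟎     = 𝟎
NF-natValue (𝐒 w) = 𝐒 (NF-natValue w)

NF-canonical : NF (proper ν) v → Canonical ν v
NF-canonical {ν = abs} ƛ = ƛ _
NF-canonical {ν = nat} w = nat (NF-natValue w)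

Evaluates : Term 0 → Nature → MultiCounter → Set
Evaluates t ν m = ∃[ ρs ] ∃[ u ] (t ⟶*[ ρs ] u × NF (proper ν) u × m ↭ ρs)

-- The type `[]` is essential at the end: there `bag` says that the counter is empty, whereas at a
-- larger multitype an abstraction could still carry names from typings of its body.
evaluate : ∀ j → length m ≡ j → Closed t₁ ([] ^ ν) m → Evaluates t₁ ν m
evaluate j e d with progress d
... | inj₁ (_ , cv) with canonical-nature cv d
evaluate j e d | inj₁ (_ , cv) | refl = [] , _ , [] , canonical-NF cv , bag cv d
evaluate j e d | inj₂ (ρ , _ , r) with subject-reduction r d
... | _ , c , d′ with j | ≡-trans (sym (↭.↭-length c)) e
... | suc j | e′ with evaluate j (suc-injective e′) d′
... | ρs , u , rs , w , c′ = ρ ∷ ρs , u , r ∷ rs , w , ↭-trans c (↭-prep ρ c′)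

type-evaluation : ∀ {ρs} → t₁ ⟶*[ ρs ] t₂ → NF (proper ν) t₂ → Closed t₁ ([] ^ ν) ρs
type-evaluation []       w = unbag (NF-canonical w) ↭-refl
type-evaluation (r ∷ rs) w = subject-expansion r (type-evaluation rs w)

theorem18 : (t : Term 0) (ν : Nature) (m : MultiCounter) →
    (Σ[ d ∈ ∅ᶠ ⨾ ∅ᵍ ⊢[ m ] t ∶ [] ^ ν ] Tight d)
    ⇔ (∃[ ρs ] ∃[ u ] (t ⟶*[ ρs ] u × NF (proper ν) u × m ↭ ρs))
theorem18 t ν m = mk⇔
  (λ (d , _) → evaluate (length m) refl d)
  (λ (_ , _ , rs , w , c) →
    recount (↭-sym c) (type-evaluation rs w) , (λ ()) , (λ ()) , ν , refl)
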